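{- Every msi-rule system $\mathtt{L}\in \mathbf{NExt}(\mathtt{KM_R})$ is axiomatisable over $\mathtt{KM_R}$ by some set of msi pre-stable canonical rules of the form $\xi(\mathfrak{H}, D^\to, D^\boxtimes)$, where $\mathfrak{H}$ is a finite fronton.
   Context: Signature $msi=\{\land,\lor,\to,\boxtimes,\bot,\top\}$. $\mathtt{KM}=\mathtt{IPCK}\oplus p\to\boxtimes p\oplus(\boxtimes p\to p)\to p\oplus\boxtimes p\to(q\lor(q\to p))$; $\mathtt{KM_R}$ is the least msi-rule system containing $/\varphi$ for $\varphi\in\mathtt{KM}$. Frontons are the algebras of $\mathtt{KM}$ (Heyting algebras with a normal operator $\boxtimes$ satisfying $a\le\boxtimes a$, $\boxtimes a\to a=a$, $\boxtimes a\le b\lor(b\to a)$). For a finite fronton $\mathfrak{H}$ and $D^\to\subseteq H\times H$, $D^\boxtimes\subseteq H$ such that $a\in D^\boxtimes$ implies $(b,a)\in D^\to$ for all $b\in H$, the msi pre-stable canonical rule $\xi(\mathfrak{H},D^\to,D^\boxtimes)$ is $\Gamma/\Delta$ with fresh variables $p_a$ ($a\in H$), where $\Gamma=\{p_0\leftrightarrow 0,p_1\leftrightarrow 1\}\cup\{p_{a\land b}\leftrightarrow p_a\land p_b,\ p_{a\lor b}\leftrightarrow p_a\lor p_b:a,b\in H\}\cup\{p_{a\to b}\leftrightarrow p_a\to p_b:(a,b)\in D^\to\}\cup\{p_{\boxtimes a}\leftrightarrow\boxtimes p_a:a\in D^\boxtimes\}$ and $\Delta=\{p_a\leftrightarrow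 p_b:a,b\in H,\ a\neq b\}$. -}

module Defs where

open import Level using (0ℓ)
open import Data.Nat using (ℕ)
open import Data.Fin using (Fin; toℕ)
open import Data.Fin.Properties using (_≟_)
open import Data.Bool using (Bool; true; false; if_then_else_)
open import Data.List using (List; []; _∷_; _++_; map; concatMap; allFin; filterᵇ)
open import Data.List.Relation.Binary.Subset.Propositional using (_⊆_)
open import Data.List.Membership.Propositional using (_∈_)
open import Data.Product using (Σ; ∃; _×_; _,_)
open import Data.Sum using (_⊎_)
open import Relation.Nullary using (¬_; does)
open import Relation.Unary using (Pred)
open import Relation.Binary using (Rel)
open import Relation.Binary.PropositionalEquality using (_≡_)
open import Relation.Binary.Lattice.Structures using (IsHeytingAlgebra)

infixr 6 _∧'_
infixr 5 _∨'_
infixr 4 _⇒_ _⇔_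

data Fm : Set where
  var  : ℕ → Fm
  _∧'_ : Fm → Fm → Fm
  _∨'_ : Fm → Fm → Fm
  _⇒_  : Fm → Fm → Fm
  ⊠    : Fm → Fm
  ⊥'   : Fm
  ⊤'   : Fm

_⇔_ : Fm → Fm → Fm
φ ⇔ ψ = (φ ⇒ ψ) ∧' (ψ ⇒ φ)

Subst : Set
Subst = ℕ → Fm

sub : Subst → Fm → Fm
sub σ (var n)  = σ n
sub σ (φ ∧' ψ) = sub σ φ ∧' sub σ ψ
sub σ (φ ∨' ψ) = sub σ φ ∨' sub σ ψ
sub σ (φ ⇒ ψ)  = sub σ φ ⇒ sub σ ψ
sub σ (⊠ φ)    = ⊠ (sub σ φ)
sub σ ⊥'       = ⊥'
sub σ ⊤'       = ⊤'

p q : Fm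
p = var 0
q = var 1

data Thm (Ax : Pred Fm 0ℓ) : Fm → Set where
  ax1  : ∀ φ ψ → Thm Ax (φ ⇒ ψ ⇒ φ)
  ax2  : ∀ φ ψ χ → Thm Ax ((φ ⇒ ψ ⇒ χ) ⇒ (φ ⇒ ψ) ⇒ φ ⇒ χ)
  ax3  : ∀ φ ψ → Thm Ax (φ ∧' ψ ⇒ φ)
  ax4  : ∀ φ ψ → Thm Ax (φ ∧' ψ ⇒ ψ)
  ax5  : ∀ φ ψ → Thm Ax (φ ⇒ ψ ⇒ φ ∧' ψ)
  ax6  : ∀ φ ψ → Thm Ax (φ ⇒ φ ∨' ψ)
  ax7  : ∀ φ ψ → Thm Ax (ψ ⇒ φ ∨' ψ)
  ax8  : ∀ φ ψ χ → Thm Ax ((φ ⇒ χ) ⇒ (ψ ⇒ χ) ⇒ φ ∨' ψ ⇒ χ)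
  ax9  : ∀ φ → Thm Ax (⊥' ⇒ φ)
  ax10 : Thm Ax ⊤'
  axK  : ∀ φ ψ → Thm Ax (⊠ (φ ⇒ ψ) ⇒ ⊠ φ ⇒ ⊠ ψ)
  axE  : ∀ {φ} → Ax φ → Thm Ax φ
  mp   : ∀ {φ ψ} → Thm Ax φ → Thm Ax (φ ⇒ ψ) → Thm Ax ψ
  nec  : ∀ {φ} → Thm Ax φ → Thm Ax (⊠ φ)
  usub : ∀ {φ} (σ : Subst) → Thm Ax φ → Thm Ax (sub σ φ)

data NoAx : Pred Fm 0ℓ where

IPCK : Pred Fm 0ℓ
IPCK = Thm NoAx

data KMAx : Pred Fm 0ℓ where
  km1 : KMAx (p ⇒ ⊠ p)
  km2 : KMAx ((⊠ p ⇒ p) ⇒ p)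
  km3 : KMAx (⊠ p ⇒ (q ∨' (q ⇒ p)))

KM : Pred Fm 0ℓ
KM = Thm KMAx

-- Rules Γ/Δ with finite premises and conclusions (lists, read as sets)

record Rule : Set where
  constructor _/_
  field
    prem : List Fm
    concl : List Fm

record IsMsiRuleSystem (S : Pred Rule 0ℓ) : Set where
  field
    refl' : ∀ φ → S ((φ ∷ []) / (φ ∷ []))
    weaken : ∀ {Γ Γ' Δ Δ'} → Γ ⊆ Γ' → Δ ⊆ Δ' → S (Γ / Δ) → S (Γ' / Δ')
    cut : ∀ {Γ Δ φ} → S (Γ / (φ ∷ Δ)) → S ((φ ∷ Γ) / Δ) → S (Γ / Δ)
    structural : ∀ {Γ Δ} (σ : Subst) → S (Γ / Δ) → S (map (sub σ) Γ / map (sub σ) Δ)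
    ipck : ∀ φ → IPCK φ → S ([] / (φ ∷ []))
    modusPonens : ∀ φ ψ → S ((φ ∷ (φ ⇒ ψ) ∷ []) / (ψ ∷ []))
    necessitation : ∀ φ → S ((φ ∷ []) / (⊠ φ ∷ []))

data Gen (R : Pred Rule 0ℓ) : Pred Rule 0ℓ where
  gen : ∀ {r} → R r → Gen R r
  refl' : ∀ φ → Gen R ((φ ∷ []) / (φ ∷ []))
  weaken : ∀ {Γ Γ' Δ Δ'} → Γ ⊆ Γ' → Δ ⊆ Δ' → Gen R (Γ / Δ) → Gen R (Γ' / Δ')
  cut : ∀ {Γ Δ φ} → Gen R (Γ / (φ ∷ Δ)) → Gen R ((φ ∷ Γ) / Δ) → Gen R (Γ / Δ)
  structural : ∀ {Γ Δ} (σ : Subst) → Gen R (Γ / Δ) → Gen R (map (sub σ) Γ / map (sub σ) Δ)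
  ipck : ∀ φ → IPCK φ → Gen R ([] / (φ ∷ []))
  modusPonens : ∀ φ ψ → Gen R ((φ ∷ (φ ⇒ ψ) ∷ []) / (ψ ∷ []))
  necessitation : ∀ φ → Gen R ((φ ∷ []) / (⊠ φ ∷ []))

KMAxRules : Pred Rule 0ℓ
KMAxRules r = Σ Fm λ φ → KM φ × (r ≡ ([] / (φ ∷ [])))

KM-R : Pred Rule 0ℓ
KM-R = Gen KMAxRules

record InNExtKMR (L : Pred Rule 0ℓ) : Set where
  field
    isMsiRuleSystem : IsMsiRuleSystem L
    extendsKMR : ∀ r → KM-R r → L r

_⊕R_ : Pred Rule 0ℓ → Pred Rule 0ℓ → Pred Rule 0ℓ
L₁ ⊕R Ξ = Gen (λ r → L₁ r ⊎ Ξ r)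

_≐_ : Pred Rule 0ℓ → Pred Rule 0ℓ → Set
L₁ ≐ L₂ = ∀ r → (L₁ r → L₂ r) × (L₂ r → L₁ r)

record FiniteFronton : Set₁ where
  field
    n    : ℕ
    _≤_  : Rel (Fin n) 0ℓ
    _∨_  : Fin n → Fin n → Fin n
    _∧_  : Fin n → Fin n → Fin n
    _⇨_  : Fin n → Fin n → Fin n
    top  : Fin n
    bot  : Fin n
    isHeytingAlgebra : IsHeytingAlgebra _≡_ _≤_ _∨_ _∧_ _⇨_ top bot
    box  : Fin n → Fin n
    box-top : box top ≡ top
    box-∧   : ∀ a b → box (a ∧ b) ≡ (box a ∧ box b)
    box-km1 : ∀ a → a ≤ box a
    box-km2 : ∀ a → (box a ⇨ a) ≡ a
    box-km3 : ∀ a b → box a ≤ (b ∨ (b ⇨ a))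

record PSCRData : Set₁ where
  field
    H     : FiniteFronton
  open FiniteFronton H
  field
    D→    : Fin n → Fin n → Bool
    D⊠    : Fin n → Bool
    D-ok  : ∀ a → D⊠ a ≡ true → ∀ b → D→ b a ≡ true

ξ : PSCRData → Rule
ξ d = Γ / Δ
  where
  open PSCRData d
  open FiniteFronton H
  P : Fin n → Fm
  P a = var (toℕ a)
  els : List (Fin n)
  els = allFin n
  pairs : List (Fin n × Fin n)
  pairs = concatMap (λ a → map (λ b → (a , b)) els) els
  Γ : List Fm
  Γ = (P bot ⇔ ⊥') ∷ (P top ⇔ ⊤')
      ∷ (map (λ { (a , b) → P (a ∧ b) ⇔ (P a ∧' P b) }) pairs
      ++ map (λ { (a , b) → P (a ∨ b) ⇔ (P a ∨' P b) }) pairs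
      ++ map (λ { (a , b) → P (a ⇨ b) ⇔ (P a ⇒ P b) })
             (filterᵇ (λ { (a , b) → D→ a b }) pairs)
      ++ map (λ a → P (box a) ⇔ ⊠ (P a)) (filterᵇ D⊠ els))
  Δ : List Fm
  Δ = concatMap (λ { (a , b) → if does (a ≟ b) then [] else ((P a ⇔ P b) ∷ []) }) pairs

module Submission where

open import Defs hiding (refl'; weaken; cut; structural; ipck; modusPonens; necessitation)
open import Level using (Level; 0ℓ; _⊔_)
open import Data.Bool using (Bool; true; false; T; if_then_else_) renaming (_∨_ to _or_)
open import Data.Bool.Properties using (T?; T-≡; ∨-zeroʳ)
open import Data.Fin using (Fin; zero; suc; toℕ)
open import Data.Fin.Properties using (_≟_)
open import Data.List using (List; []; _∷_; [_]; _++_; allFin; cartesianProductWith; concatMap; filter; filterᵇ; foldr; length; map)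
open import Data.List.Membership.Propositional using (_∈_; find; lose)
open import Data.List.Membership.Propositional.Properties using (∈-++⁺ˡ; ∈-++⁺ʳ; ∈-++⁻; ∈-allFin; ∈-cartesianProductWith⁺; ∈-cartesianProductWith⁻; ∈-concatMap⁺; ∈-concatMap⁻; ∈-filter⁺; ∈-filter⁻; ∈-map⁺; ∈-map⁻)
open import Data.List.Properties using (length-removeAt′)
open import Data.List.Relation.Binary.Subset.Propositional using (_⊆_)
open import Data.List.Relation.Binary.Subset.Propositional.Properties using (∷⁺ʳ; ∈-∷⁺ʳ)
open import Data.List.Relation.Unary.All using (tabulate) renaming (lookup to lookupAll)
open import Data.List.Relation.Unary.AllPairs using (AllPairs; []; _∷_)
open import Data.List.Relation.Unary.Any using (here; there; any?; index; _─_)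
open import Data.Nat using (ℕ; zero; suc)
import Data.Nat as ℕ
import Data.Nat.Properties as ℕ
open import Data.Product using (Σ; ∃; _×_; _,_; proj₁; proj₂)
open import Data.Sum using (_⊎_; inj₁; inj₂; [_,_]′)
import Data.Sum as Sum
open import Function using (_∘_; id; Equivalence)
open import Relation.Binary using (Rel)
open import Relation.Binary.Lattice using (HeytingAlgebra; IsBoundedLattice; IsHeytingAlgebra)
open import Relation.Binary.PropositionalEquality using (_≡_; _≢_; refl; sym; trans; cong; subst; isEquivalence)
open import Relation.Nullary using (Dec; yes; no; does; contradiction; _×-dec_)
open import Relation.Nullary.Decidable using (dec-true)
open import Relation.Unary using (Pred)

-- L is axiomatised by the canonical rules it contains, because a rule r is interderivable with the
-- canonical rules ξ(H, D→, D⊠) read off its refutations by valuations V in finite frontons H. That r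
-- derives these is seen by substituting p_{V(p)} for p. For the converse, let D consist of the φ such that
-- ⊠ φ is a subformula of r, and close the subformulas of r under ⊤, ⊥, ∧, ∨ and the maps _⇒ φ with φ in D.
-- Up to equivalence in IPC this closure F is finite, a relative form of Diego's theorem. By cuts on all
-- implications between members of F it suffices to derive the sequents Γ / Δ that extend r and contain each
-- of these implications on one side. The implications in Γ turn F into a finite distributive lattice H.
-- Its fronton operator is forced to be a ↦ ⋀_b (b ∨ (b ⇨ a)) and agrees with ⊠ on D, where H computes
-- all implications b ⇒ a correctly. Either r fails in H and a canonical rule applies, or Γ / Δ is derivable
-- already.
--
-- As derivability is undecidable, facts about H are obtained in the form "the fact, or S (Γ / Δ)", and
-- finite conjunctions commute with this disjunction.

-- Case distinctions over finite lists

private variable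
  a b c ℓ₁ ℓ₂ : Level
  A C X Y : Set a
  Pos : A → Set b
  Neg : A → Set c

-- The choice is made by inspecting the given disjunctions one by one; this stands in for
-- decidability of `Pos`.
all⊎any : {xs : List A} → (∀ {x} → x ∈ xs → Pos x ⊎ Neg x) →
          (∀ {x} → x ∈ xs → Pos x) ⊎ (∃ λ x → x ∈ xs × Neg x)
all⊎any {xs = []}     f = inj₁ λ ()
all⊎any {xs = x ∷ xs} f with f (here refl) | all⊎any (f ∘ there)
... | inj₂ q | _                   = inj₂ (x , here refl , q)
... | inj₁ _ | inj₂ (y , y∈xs , q) = inj₂ (y , there y∈xs , q)
... | inj₁ p | inj₁ ps             = inj₁ λ { (here refl) → p ; (there y∈xs) → ps y∈xs }

select : {xs : List A} → (∀ {x} → x ∈ xs → Pos x ⊎ Neg x) →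
         ∃ λ ys → ys ⊆ xs × (∀ {x} → x ∈ ys → Pos x) × (∀ {x} → x ∈ xs → x ∈ ys ⊎ Neg x)
select {xs = []}     f = [] , id , (λ ()) , λ ()
select {xs = x ∷ xs} f with f (here refl) | select (f ∘ there)
... | inj₁ p | ys , ys⊆xs , ps , rest =
  x ∷ ys
  , (λ { (here refl) → here refl ; (there y∈ys) → there (ys⊆xs y∈ys) })
  , (λ { (here refl) → p ; (there y∈ys) → ps y∈ys })
  , λ { (here refl) → inj₁ (here refl) ; (there y∈xs) → Sum.map₁ there (rest y∈xs) }
... | inj₂ q | ys , ys⊆xs , ps , rest =
  ys , there ∘ ys⊆xs , ps , λ { (here refl) → inj₂ q ; (there y∈xs) → rest y∈xs }

∈-─ : {xs : List A} {x y : A} (x∈xs : x ∈ xs) → y ∈ xs → y ∈ (xs ─ x∈xs) ⊎ y ≡ x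
∈-─ (here refl)  (here eq)    = inj₂ eq
∈-─ (here refl)  (there y∈xs) = inj₁ y∈xs
∈-─ (there x∈xs) (here eq)    = inj₁ (here eq)
∈-─ (there x∈xs) (there y∈xs) = Sum.map₁ there (∈-─ x∈xs y∈xs)

-- A relative form of Diego's theorem

module HeytingLemmas {c ℓ₁ ℓ₂} (𝔸 : HeytingAlgebra c ℓ₁ ℓ₂) where

  open HeytingAlgebra 𝔸 hiding (refl; trans)
  open HeytingAlgebra 𝔸 public using () renaming (refl to ≤-refl; trans to ≤-trans)
  open import Relation.Binary.Lattice.Properties.HeytingAlgebra 𝔸 public
    using (⇨-eval; ⇨ˡ-contravariant; ⇨ʳ-covariant; ⇨-cong; y≤x⇨y; ∧-distribˡ-∨-≤)
  open import Relation.Binary.Lattice.Properties.MeetSemilattice meetSemilattice public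
    using (∧-monotonic; ∧-cong)
  open import Relation.Binary.Lattice.Properties.JoinSemilattice joinSemilattice public
    using (∨-monotonic; ∨-cong)

  π₁ : ∀ {x y} → x ∧ y ≤ x
  π₁ = x∧y≤x _ _

  π₂ : ∀ {x y} → x ∧ y ≤ y
  π₂ = x∧y≤y _ _

  ι₁ : ∀ {x y} → x ≤ x ∨ y
  ι₁ = x≤x∨y _ _

  ι₂ : ∀ {x y} → y ≤ x ∨ y
  ι₂ = y≤x∨y _ _

  ∧∨-elim : ∀ {x y z u} → x ∧ y ≤ u → x ∧ z ≤ u → x ∧ (y ∨ z) ≤ u
  ∧∨-elim p q = ≤-trans (∧-distribˡ-∨-≤ _ _ _) (∨-least p q)

module RelativeImplicationClosure
  {c ℓ₁ ℓ₂} (𝔸 : HeytingAlgebra c ℓ₁ ℓ₂)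
  (G D : List (HeytingAlgebra.Carrier 𝔸)) (D⊆G : D ⊆ G)
  where

  open HeytingAlgebra 𝔸 hiding (refl; trans)
  open HeytingLemmas 𝔸

  data Cl : Carrier → Set (c ⊔ ℓ₁ ⊔ ℓ₂) where
    cl-gen  : ∀ {x} → x ∈ G → Cl x
    cl-⊤  : Cl ⊤
    cl-⊥  : Cl ⊥
    cl-∧ : ∀ {x y} → Cl x → Cl y → Cl (x ∧ y)
    cl-∨ : ∀ {x y} → Cl x → Cl y → Cl (x ∨ y)
    cl-⇨  : ∀ {x d} → Cl x → d ∈ D → Cl (x ⇨ d)

  -- The meets ⋀ X ∧ ⋀ {b ⇨ d ∣ b ∈ B ∖ X} for X ⊆ B: they behave like the points at which d fails,
  -- each described by the set X of elements of B that hold there.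
  points : Carrier → List Carrier → List Carrier
  points d []      = ⊤ ∷ []
  points d (b ∷ B) = map (b ∧_) (points d B) ++ map ((b ⇨ d) ∧_) (points d B)

  -- The point `k` forces `x` or refutes it, where refuting means that adding `x` yields `d`, the
  -- element meant to fail at `k`.
  Decides : Carrier → Carrier → Carrier → Set ℓ₂
  Decides d k x = k ≤ x ⊎ k ∧ x ≤ d

  weaken-Decides : ∀ {d k k′ x} → k′ ≤ k → Decides d k x → Decides d k′ x
  weaken-Decides k′≤k = Sum.map (≤-trans k′≤k) (≤-trans (∧-monotonic k′≤k ≤-refl))

  point-decides : ∀ {d k b} B → k ∈ points d B → b ∈ B → Decides d k b
  point-decides {d} (b ∷ B) k∈ b∈ with ∈-++⁻ (map (b ∧_) (points d B)) k∈
  point-decides (b ∷ B) k∈ b∈ | inj₁ k∈ˡ with ∈-map⁻ (b ∧_) k∈ˡ | b∈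
  ... | k , _  , refl | here refl = inj₁ π₁
  ... | k , k∈ , refl | there b∈B = weaken-Decides π₂ (point-decides B k∈ b∈B)
  point-decides {d} (b ∷ B) k∈ b∈ | inj₂ k∈ʳ with ∈-map⁻ ((b ⇨ d) ∧_) k∈ʳ | b∈
  ... | k , _  , refl | here refl = inj₂ (≤-trans (∧-monotonic π₁ ≤-refl) ⇨-eval)
  ... | k , k∈ , refl | there b∈B = weaken-Decides π₂ (point-decides B k∈ b∈B)

  -- A case split on `b` that is valid intuitionistically because the goal is `d`: from `e ∧ b ≤ d`
  -- follows `e ≤ b ⇨ d`, so `e ∧ (b ⇨ d) ≤ d` gives `e ≤ d`.
  points-cover : ∀ {d e} B → (∀ {k} → k ∈ points d B → e ∧ k ≤ d) → e ≤ d
  points-cover []      f = ≤-trans (∧-greatest ≤-refl (maximum _)) (f (here refl))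
  points-cover {d} {e} (b ∷ B) f =
    ≤-trans (∧-greatest ≤-refl (transpose-⇨ e∧b≤d)) e∧¬b≤d
    where
    assoc : ∀ {x y z} → (x ∧ y) ∧ z ≤ x ∧ (y ∧ z)
    assoc = ∧-greatest (≤-trans π₁ π₁) (∧-monotonic π₂ ≤-refl)
    e∧b≤d : e ∧ b ≤ d
    e∧b≤d = points-cover B λ k∈ → ≤-trans assoc (f (∈-++⁺ˡ (∈-map⁺ (b ∧_) k∈)))
    e∧¬b≤d : e ∧ (b ⇨ d) ≤ d
    e∧¬b≤d = points-cover B λ k∈ →
      ≤-trans assoc (f (∈-++⁺ʳ (map (b ∧_) (points d B)) (∈-map⁺ ((b ⇨ d) ∧_) k∈)))

  -- Modulo c, every implication from Cl into an element of D is a meet of members of imps m c, provided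
  -- at most m elements of D are not yet above c (see imps-complete).
  imps : ℕ → Carrier → List Carrier
  basis : ℕ → Carrier → Carrier → List Carrier
  imps zero    c = []
  imps (suc m) c = concatMap (λ d → map (λ k → c ∧ k ⇨ d) (points d (basis m c d))) D
  basis m c d = G ++ imps m (c ∧ d)

  -- Says that `c ∧ x ⇨ d` is the greatest lower bound of some `ws` among `vs`. The bound by
  -- `c ∧ x ⇨ d` is stated in transposed form, as `e ∧ (c ∧ x) ≤ d`.
  MeetOf : List Carrier → Carrier → Carrier → Carrier → Set (c ⊔ ℓ₂)
  MeetOf vs c x d = ∃ λ ws → ws ⊆ vs × (∀ {w} → w ∈ ws → c ∧ x ⇨ d ≤ w)
                                    × (∀ {e} → (∀ {w} → w ∈ ws → e ≤ w) → e ∧ (c ∧ x) ≤ d)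

  module _ {m c d} (rec : ∀ {x d′} → Cl x → d′ ∈ D → MeetOf (imps m (c ∧ d)) (c ∧ d) x d′)
           {k} (k∈ : k ∈ points d (basis m c d)) where

    basis-decided : ∀ {b} → b ∈ basis m c d → Decides d (c ∧ k) b
    basis-decided = weaken-Decides π₂ ∘ point-decides (basis m c d) k∈

    -- For x ⇨ d′, the value strictly above the point is described by rec, the value at the point itself
    -- by the induction hypotheses for x and d′.
    Cl-decided : ∀ {x} → Cl x → Decides d (c ∧ k) x
    Cl-decided (cl-gen x∈G) = basis-decided (∈-++⁺ˡ x∈G)
    Cl-decided cl-⊤ = inj₁ (maximum _)
    Cl-decided cl-⊥ = inj₂ (≤-trans π₂ (minimum _))
    Cl-decided (cl-∧ p q) with Cl-decided p | Cl-decided q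
    ... | inj₁ u | inj₁ v = inj₁ (∧-greatest u v)
    ... | inj₂ u | _      = inj₂ (≤-trans (∧-monotonic ≤-refl π₁) u)
    ... | inj₁ _ | inj₂ v = inj₂ (≤-trans (∧-monotonic ≤-refl π₂) v)
    Cl-decided (cl-∨ p q) with Cl-decided p | Cl-decided q
    ... | inj₁ u | _      = inj₁ (≤-trans u ι₁)
    ... | inj₂ _ | inj₁ v = inj₁ (≤-trans v ι₂)
    ... | inj₂ u | inj₂ v = inj₂ (∧∨-elim u v)
    Cl-decided (cl-⇨ {x} {d′} p d′∈D) with rec p d′∈D
    ... | ws , ws⊆ , below , above
      with all⊎any (λ w∈ → basis-decided (∈-++⁺ʳ G (ws⊆ w∈)))
    ... | inj₂ (w , w∈ , k∧w≤d) =
      inj₂ (≤-trans (∧-monotonic ≤-refl (≤-trans (⇨ˡ-contravariant π₂) (below w∈))) k∧w≤d)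
    ... | inj₁ k≤ws with Cl-decided p | basis-decided (∈-++⁺ˡ (D⊆G d′∈D))
    ...   | _      | inj₁ k≤d′ = inj₁ (≤-trans k≤d′ y≤x⇨y)
    ...   | inj₁ k≤x | inj₂ k∧d′≤d =
      inj₂ (≤-trans (∧-greatest π₁ (≤-trans (∧-greatest π₂ (≤-trans π₁ k≤x)) ⇨-eval)) k∧d′≤d)
    -- Assuming `x` at this point yields `d`, which leads into the region described by `ws`; as all
    -- of `ws` hold, `d′` follows there.
    ...   | inj₂ k∧x≤d | inj₂ _ =
      inj₁ (transpose-⇨ (≤-trans
        (∧-greatest π₁ (∧-greatest (∧-greatest (≤-trans π₁ π₁) k∧x≤d) π₂))
        (above k≤ws)))

  -- `R` lists the elements of `D` not yet known to lie above `c`. The recursion at `c ∧ d` removes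
  -- `d` from it, so `m` bounds the depth. The implication is the meet of the `c ∧ k ⇨ d` over the
  -- points `k` that force `x`; at the other points `x` already yields `d`.
  imps-complete : ∀ {c} (R : List Carrier) → (∀ {d} → d ∈ D → d ∈ R ⊎ c ≤ d) →
                  ∀ m → length R ℕ.≤ m →
                  ∀ {x d} → Cl x → d ∈ D → MeetOf (imps m c) c x d
  imps-complete R R-rest m R≤m p d∈D with R-rest d∈D
  -- The implication is top here, hence the empty meet.
  ... | inj₂ c≤d = [] , (λ ()) , (λ ()) , λ _ → ≤-trans π₂ (≤-trans π₁ c≤d)
  imps-complete {c} R@(_ ∷ _) R-rest (suc m) R≤m {x} {d} p d∈D | inj₁ d∈R = go
    where
    R′ = R ─ d∈R
    R′-rest : ∀ {d′} → d′ ∈ D → d′ ∈ R′ ⊎ c ∧ d ≤ d′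
    R′-rest d′∈D with R-rest d′∈D
    ... | inj₂ c≤d′ = inj₂ (≤-trans π₁ c≤d′)
    ... | inj₁ d′∈R with ∈-─ d∈R d′∈R
    ...   | inj₁ d′∈R′ = inj₁ d′∈R′
    ...   | inj₂ refl  = inj₂ π₂
    R′≤m : length R′ ℕ.≤ m
    R′≤m = ℕ.s≤s⁻¹ (subst (ℕ._≤ suc m) (length-removeAt′ R (index d∈R)) R≤m)
    pts = points d (basis m c d)
    go : MeetOf (imps (suc m) c) c x d
    go with select {xs = pts} (λ k∈ → Cl-decided {m = m} (imps-complete R′ R′-rest m R′≤m) k∈ p)
    ... | ks , ks⊆ , k≤x , rest =
      map (λ k → c ∧ k ⇨ d) ks , ks-imps , below , above
      where
      ks-imps : map (λ k → c ∧ k ⇨ d) ks ⊆ imps (suc m) c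
      ks-imps w∈ with ∈-map⁻ (λ k → c ∧ k ⇨ d) w∈
      ... | k , k∈ , refl = ∈-concatMap⁺ _ (lose d∈D (∈-map⁺ _ (ks⊆ k∈)))
      below : ∀ {w} → w ∈ map (λ k → c ∧ k ⇨ d) ks → c ∧ x ⇨ d ≤ w
      below w∈ with ∈-map⁻ (λ k → c ∧ k ⇨ d) w∈
      ... | k , k∈ , refl = ⇨ˡ-contravariant (∧-greatest π₁ (k≤x k∈))
      above : ∀ {e} → (∀ {w} → w ∈ map (λ k → c ∧ k ⇨ d) ks → e ≤ w) → e ∧ (c ∧ x) ≤ d
      above f = points-cover (basis m c d) λ k∈ → [ (λ k∈ks → ≤-trans
          (∧-greatest (≤-trans (≤-trans π₁ π₁) (f (∈-map⁺ _ k∈ks)))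
                      (∧-greatest (≤-trans π₁ (≤-trans π₂ π₁)) π₂)) ⇨-eval)
        , (λ k∧x≤d → ≤-trans
          (∧-greatest (∧-greatest (≤-trans π₁ (≤-trans π₂ π₁)) π₂) (≤-trans π₁ (≤-trans π₂ π₂)))
          k∧x≤d) ]′ (rest k∈)

  points-Cl : ∀ {d k} B → d ∈ D → (∀ {b} → b ∈ B → Cl b) → k ∈ points d B → Cl k
  points-Cl []      d∈D f (here refl) = cl-⊤
  points-Cl {d} (b ∷ B) d∈D f k∈ with ∈-++⁻ (map (b ∧_) (points d B)) k∈
  ... | inj₁ k∈ˡ with ∈-map⁻ (b ∧_) k∈ˡ
  ...   | _ , k∈ , refl = cl-∧ (f (here refl)) (points-Cl B d∈D (f ∘ there) k∈)
  points-Cl {d} (b ∷ B) d∈D f k∈ | inj₂ k∈ʳ with ∈-map⁻ ((b ⇨ d) ∧_) k∈ʳ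
  ...   | _ , k∈ , refl = cl-∧ (cl-⇨ (f (here refl)) d∈D) (points-Cl B d∈D (f ∘ there) k∈)

  imps-Cl : ∀ m {c w} → Cl c → w ∈ imps m c → Cl w
  imps-Cl (suc m) {c} p w∈ with find 
    (∈-concatMap⁻ (λ d → map (λ k → c ∧ k ⇨ d) (points d (basis m c d))) {xs = D} w∈)
  ... | d , d∈D , w∈′ with ∈-map⁻ (λ k → c ∧ k ⇨ d) w∈′
  ...   | k , k∈ , refl = cl-⇨ (cl-∧ p (points-Cl (basis m c d) d∈D basis-Cl k∈)) d∈D
    where
    basis-Cl : ∀ {b} → b ∈ basis m c d → Cl b
    basis-Cl b∈ = [ cl-gen , imps-Cl m (cl-∧ p (cl-gen (D⊆G d∈D))) ]′ (∈-++⁻ G b∈)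

  -- By distributivity, adjoining `b` to a bounded sublattice adds only elements of the form
  -- `x ∨ b ∧ y` with `x` and `y` from that sublattice.
  sublattice : List Carrier → List Carrier
  sublattice []      = ⊤ ∷ ⊥ ∷ []
  sublattice (b ∷ B) = cartesianProductWith (λ x y → x ∨ b ∧ y) (sublattice B) (sublattice B)

  _∈≈_ : Carrier → List Carrier → Set (c ⊔ ℓ₁)
  x ∈≈ xs = ∃ λ y → y ∈ xs × x ≈ y

  ∈≈-resp : ∀ {x y xs} → x ≈ y → y ∈≈ xs → x ∈≈ xs
  ∈≈-resp x≈y (z , z∈ , y≈z) = z , z∈ , Eq.trans x≈y y≈z

  sublattice-cons : ∀ {x y} b B → x ∈≈ sublattice B → y ∈≈ sublattice B →
                    (x ∨ b ∧ y) ∈≈ sublattice (b ∷ B)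
  sublattice-cons b B (x , x∈ , x≈) (y , y∈ , y≈) =
    x ∨ b ∧ y , ∈-cartesianProductWith⁺ _ x∈ y∈ , ∨-cong x≈ (∧-cong Eq.refl y≈)

  sublattice-⊥ : ∀ B → ⊥ ∈≈ sublattice B
  sublattice-⊥ []      = ⊥ , there (here refl) , Eq.refl
  sublattice-⊥ (b ∷ B) = ∈≈-resp (antisym (minimum _) (∨-least ≤-refl π₂))
    (sublattice-cons b B (sublattice-⊥ B) (sublattice-⊥ B))

  sublattice-⊤ : ∀ B → ⊤ ∈≈ sublattice B
  sublattice-⊤ []      = ⊤ , here refl , Eq.refl
  sublattice-⊤ (b ∷ B) = ∈≈-resp (antisym ι₁ (maximum _))
    (sublattice-cons b B (sublattice-⊤ B) (sublattice-⊤ B))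

  sublattice-gen : ∀ {b} B → b ∈ B → b ∈≈ sublattice B
  sublattice-gen (b ∷ B) (here refl) =
    ∈≈-resp (antisym (≤-trans (∧-greatest ≤-refl (maximum _)) ι₂) (∨-least (minimum _) π₁))
      (sublattice-cons b B (sublattice-⊥ B) (sublattice-⊤ B))
  sublattice-gen (b ∷ B) (there b∈B) =
    ∈≈-resp (antisym ι₁ (∨-least ≤-refl (≤-trans π₂ (minimum _))))
      (sublattice-cons b B (sublattice-gen B b∈B) (sublattice-⊥ B))

  sublattice-∨ : ∀ {x y} B → x ∈ sublattice B → y ∈ sublattice B → (x ∨ y) ∈≈ sublattice B
  sublattice-∨ [] (here refl) _ = ⊤ , here refl , antisym (maximum _) ι₁
  sublattice-∨ [] (there (here refl)) (here refl) = ⊤ , here refl , antisym (maximum _) ι₂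
  sublattice-∨ [] (there (here refl)) (there (here refl)) =
    ⊥ , there (here refl) , antisym (∨-least ≤-refl ≤-refl) (minimum _)
  sublattice-∨ (b ∷ B) p q
    with ∈-cartesianProductWith⁻ (λ x y → x ∨ b ∧ y) (sublattice B) (sublattice B) p
       | ∈-cartesianProductWith⁻ (λ x y → x ∨ b ∧ y) (sublattice B) (sublattice B) q
  ... | x , y , x∈ , y∈ , refl | x′ , y′ , x′∈ , y′∈ , refl =
    ∈≈-resp (antisym
      (∨-least (∨-monotonic ι₁ (∧-monotonic ≤-refl ι₁)) (∨-monotonic ι₂ (∧-monotonic ≤-refl ι₂)))
      (∨-least (∨-monotonic ι₁ ι₁) (∧∨-elim (≤-trans ι₂ ι₁) (≤-trans ι₂ ι₂))))
      (sublattice-cons b B (sublattice-∨ B x∈ x′∈) (sublattice-∨ B y∈ y′∈))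

  -- Rests on the identity `(x ∨ b ∧ y) ∧ (x′ ∨ b ∧ y′) ≈ (x ∧ x′) ∨ b ∧ ((x ∨ y) ∧ (x′ ∨ y′))`,
  -- which is again in normal form.
  sublattice-∧ : ∀ {x y} B → x ∈ sublattice B → y ∈ sublattice B → (x ∧ y) ∈≈ sublattice B
  ∈≈-∧ : ∀ {x y} B → x ∈≈ sublattice B → y ∈≈ sublattice B → (x ∧ y) ∈≈ sublattice B
  ∈≈-∧ B (x , x∈ , x≈) (y , y∈ , y≈) = ∈≈-resp (∧-cong x≈ y≈) (sublattice-∧ B x∈ y∈)
  sublattice-∧ [] (here refl) (here refl) = ⊤ , here refl , antisym (maximum _) (∧-greatest ≤-refl ≤-refl)
  sublattice-∧ [] (here refl) (there (here refl)) = ⊥ , there (here refl) , antisym π₂ (minimum _)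
  sublattice-∧ [] (there (here refl)) _ = ⊥ , there (here refl) , antisym π₁ (minimum _)
  sublattice-∧ (b ∷ B) p q
    with ∈-cartesianProductWith⁻ (λ x y → x ∨ b ∧ y) (sublattice B) (sublattice B) p
       | ∈-cartesianProductWith⁻ (λ x y → x ∨ b ∧ y) (sublattice B) (sublattice B) q
  ... | x , y , x∈ , y∈ , refl | x′ , y′ , x′∈ , y′∈ , refl =
    ∈≈-resp (antisym
      (∧∨-elim
        (swap (∧∨-elim (≤-trans (∧-greatest π₂ π₁) ι₁)
          (≤-trans (∧-greatest (≤-trans π₂ π₁)
            (∧-greatest (≤-trans π₂ (≤-trans π₂ ι₂)) (≤-trans π₁ ι₁))) ι₂)))
        (≤-trans (∧-greatest (≤-trans π₂ π₁)
           (∧-greatest (≤-trans π₁ (∨-monotonic ≤-refl π₂)) (≤-trans π₂ (≤-trans π₂ ι₂)))) ι₂))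
      (∨-least (∧-greatest (≤-trans π₁ ι₁) (≤-trans π₂ ι₁))
        (∧-greatest (≤-trans (∧-monotonic ≤-refl π₁) (∧∨-elim (≤-trans π₂ ι₁) ι₂))
                    (≤-trans (∧-monotonic ≤-refl π₂) (∧∨-elim (≤-trans π₂ ι₁) ι₂)))))
      (sublattice-cons b B (sublattice-∧ B x∈ x′∈)
        (∈≈-∧ B (sublattice-∨ B x∈ y∈) (sublattice-∨ B x′∈ y′∈)))
    where
    swap : ∀ {x y z} → y ∧ x ≤ z → x ∧ y ≤ z
    swap = ≤-trans (∧-greatest π₂ π₁)

  sublattice-Cl : ∀ {x} B → (∀ {b} → b ∈ B → Cl b) → x ∈ sublattice B → Cl x
  sublattice-Cl [] f (here refl) = cl-⊤
  sublattice-Cl [] f (there (here refl)) = cl-⊥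
  sublattice-Cl (b ∷ B) f x∈
    with ∈-cartesianProductWith⁻ (λ x y → x ∨ b ∧ y) (sublattice B) (sublattice B) x∈
  ... | x , y , x∈B , y∈B , refl =
    cl-∨ (sublattice-Cl B (f ∘ there) x∈B) (cl-∧ (f (here refl)) (sublattice-Cl B (f ∘ there) y∈B))

  -- With `c` equal to `⊤` no element of `D` is assumed, so the recursion needs depth `length D`.
  generators : List Carrier
  generators = G ++ imps (length D) ⊤

  closure : List Carrier
  closure = sublattice generators

  closure-gen : ∀ {x} → x ∈ G → x ∈≈ closure
  closure-gen x∈G = sublattice-gen generators (∈-++⁺ˡ x∈G)

  -- `imps-complete` at `⊤` presents the implication as a meet of generators, and the sublattice has
  -- meets up to `≈`.
  closure-⇨ : ∀ {x d} → x ∈ closure → d ∈ D → (x ⇨ d) ∈≈ closure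
  closure-⇨ {x} {d} x∈ d∈D
    with imps-complete {⊤} D inj₁ (length D) ℕ.≤-refl (sublattice-Cl generators gens-Cl x∈) d∈D
    where
    gens-Cl : ∀ {b} → b ∈ generators → Cl b
    gens-Cl b∈ = [ cl-gen , imps-Cl (length D) cl-⊤ ]′ (∈-++⁻ G b∈)
  ... | ws , ws⊆ , below , above = ∈≈-resp
    (antisym (⋀-greatest ws λ w∈ → ≤-trans (⇨ˡ-contravariant π₂) (below w∈))
             (transpose-⇨ (≤-trans (∧-monotonic ≤-refl (∧-greatest (maximum _) ≤-refl))
                                   (above (⋀-lower ws)))))
    (⋀∈≈ ws (∈-++⁺ʳ G ∘ ws⊆))
    where
    ⋀ : List Carrier → Carrier
    ⋀ = foldr _∧_ ⊤
    ⋀-greatest : ∀ {e} ws → (∀ {w} → w ∈ ws → e ≤ w) → e ≤ ⋀ ws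
    ⋀-greatest []       f = maximum _
    ⋀-greatest (w ∷ ws) f = ∧-greatest (f (here refl)) (⋀-greatest ws (f ∘ there))
    ⋀-lower : ∀ {w} ws → w ∈ ws → ⋀ ws ≤ w
    ⋀-lower (w ∷ ws) (here refl) = π₁
    ⋀-lower (w ∷ ws) (there w∈)  = ≤-trans π₂ (⋀-lower ws w∈)
    ⋀∈≈ : ∀ ws → ws ⊆ generators → ⋀ ws ∈≈ closure
    ⋀∈≈ []       f = sublattice-⊤ generators
    ⋀∈≈ (w ∷ ws) f = ∈≈-∧ generators (sublattice-gen generators (f (here refl))) (⋀∈≈ ws (f ∘ there))

-- Finite frontons

-- The order is Boolean valued so that `⇨` can be computed as the join of a filtered list.
record FiniteDistributiveLattice : Set where
  field
    n : ℕ
    leq : Fin n → Fin n → Bool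
    _∨_ _∧_ : Fin n → Fin n → Fin n
    top bot : Fin n
    isBoundedLattice : IsBoundedLattice _≡_ (λ i j → T (leq i j)) _∨_ _∧_ top bot
    distrib : ∀ i j k → T (leq (i ∧ (j ∨ k)) ((i ∧ j) ∨ (i ∧ k)))

module FiniteHeyting (𝕃 : FiniteDistributiveLattice) where

  open FiniteDistributiveLattice 𝕃
  private module 𝕃 = IsBoundedLattice isBoundedLattice

  _≤_ : Fin n → Fin n → Set
  i ≤ j = T (leq i j)

  ⋁ : List (Fin n) → Fin n
  ⋁ = foldr _∨_ bot

  ⋁-upper : ∀ {i} is → i ∈ is → i ≤ ⋁ is
  ⋁-upper (i ∷ is) (here refl) = 𝕃.x≤x∨y _ _
  ⋁-upper (i ∷ is) (there i∈)  = 𝕃.trans (⋁-upper is i∈) (𝕃.y≤x∨y _ _)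

  ∧-⋁-least : ∀ {i j} is → (∀ {k} → k ∈ is → (i ∧ k) ≤ j) → (i ∧ ⋁ is) ≤ j
  ∧-⋁-least []       f = 𝕃.trans (𝕃.x∧y≤y _ _) (𝕃.minimum _)
  ∧-⋁-least (k ∷ is) f =
    𝕃.trans (distrib _ _ _) (𝕃.∨-least (f (here refl)) (∧-⋁-least is (f ∘ there)))

  _⇨_ : Fin n → Fin n → Fin n
  i ⇨ j = ⋁ (filter (λ k → T? (leq (i ∧ k) j)) (allFin n))

  ∧-swap : ∀ {i j} → (i ∧ j) ≤ (j ∧ i)
  ∧-swap = 𝕃.∧-greatest (𝕃.x∧y≤y _ _) (𝕃.x∧y≤x _ _)

  isHeytingAlgebra : IsHeytingAlgebra _≡_ _≤_ _∨_ _∧_ _⇨_ top bot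
  isHeytingAlgebra = record
    { isBoundedLattice = isBoundedLattice
    ; exponential = λ k i j →
        (λ k∧i≤j → ⋁-upper _ (∈-filter⁺ (λ k → T? (leq (i ∧ k) j)) (∈-allFin k) (𝕃.trans ∧-swap k∧i≤j)))
      , (λ k≤i⇨j → 𝕃.trans (𝕃.∧-greatest (𝕃.x∧y≤y _ _) (𝕃.trans (𝕃.x∧y≤x _ _) k≤i⇨j))
                    (∧-⋁-least _ λ k∈ → proj₂ (∈-filter⁻ (λ k → T? (leq (i ∧ k) j)) {xs = allFin n} k∈)))
    }

  heytingAlgebra : HeytingAlgebra 0ℓ 0ℓ 0ℓ
  heytingAlgebra = record { isHeytingAlgebra = isHeytingAlgebra }

  open HeytingAlgebra heytingAlgebra
    using (antisym; maximum; transpose-⇨; ∧-greatest)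
  open HeytingLemmas heytingAlgebra

  ⋀ : List (Fin n) → Fin n → Fin n
  ⋀ bs a = foldr (λ b e → (b ∨ (b ⇨ a)) ∧ e) top bs

  ⋀-lower : ∀ {b a} bs → b ∈ bs → ⋀ bs a ≤ (b ∨ (b ⇨ a))
  ⋀-lower (b ∷ bs) (here refl) = π₁
  ⋀-lower (b ∷ bs) (there b∈)  = ≤-trans π₂ (⋀-lower bs b∈)

  ⋀-greatest : ∀ {e a} bs → (∀ b → e ≤ (b ∨ (b ⇨ a))) → e ≤ ⋀ bs a
  ⋀-greatest []       f = maximum _
  ⋀-greatest (b ∷ bs) f = ∧-greatest (f b) (⋀-greatest bs f)

  -- Factors are dropped one at a time: `e ∧ (b ∨ (b ⇨ a)) ≤ a` gives `e ∧ b ≤ a`, hence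
  -- `e ≤ b ⇨ a`, so `e` lies below the factor itself. This yields `box-km2`.
  ⋀-dense : ∀ {e a} bs → (e ∧ ⋀ bs a) ≤ a → e ≤ a
  ⋀-dense []       p = ≤-trans (∧-greatest ≤-refl (maximum _)) p
  ⋀-dense {e} {a} (b ∷ bs) p = ≤-trans (∧-greatest ≤-refl (≤-trans e≤b⇨a ι₂)) e′≤a
    where
    e′≤a : (e ∧ (b ∨ (b ⇨ a))) ≤ a
    e′≤a = ⋀-dense bs (≤-trans
      (∧-greatest (≤-trans π₁ π₁) (∧-greatest (≤-trans π₁ π₂) π₂)) p)
    e≤b⇨a : e ≤ (b ⇨ a)
    e≤b⇨a = transpose-⇨ (≤-trans (∧-monotonic ≤-refl ι₁) e′≤a)

  -- The only possible fronton operator: box-km3 bounds box a by every b ∨ (b ⇨ a), and by box-km2 and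
  -- box-km1 the bound is attained at b = box a.
  box : Fin n → Fin n
  box = ⋀ (allFin n)

  box-lower : ∀ a b → box a ≤ (b ∨ (b ⇨ a))
  box-lower a b = ⋀-lower (allFin n) (∈-allFin b)

  box-greatest : ∀ {e a} → (∀ b → e ≤ (b ∨ (b ⇨ a))) → e ≤ box a
  box-greatest = ⋀-greatest (allFin n)

  box-monotonic : ∀ {a b} → a ≤ b → box a ≤ box b
  box-monotonic a≤b = box-greatest λ c →
    ≤-trans (box-lower _ c) (∨-monotonic ≤-refl (⇨ʳ-covariant a≤b))

  fronton : FiniteFronton
  fronton = record
    { isHeytingAlgebra = isHeytingAlgebra
    ; box     = box
    ; box-top = antisym (maximum _) (box-greatest λ b → ≤-trans (y≤x⇨y {x = b}) ι₂)
    ; box-∧   = λ a b → antisym (∧-greatest (box-monotonic π₁) (box-monotonic π₂))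
        (box-greatest λ c → ≤-trans (∧-monotonic (box-lower a c) (box-lower b c))
          (∧∨-elim (≤-trans π₂ ι₁)
            (≤-trans (∧-greatest π₂ π₁)
              (∧∨-elim (≤-trans π₂ ι₁)
                (≤-trans (transpose-⇨ (∧-greatest
                   (≤-trans (∧-monotonic π₂ ≤-refl) ⇨-eval)
                   (≤-trans (∧-monotonic π₁ ≤-refl) ⇨-eval))) ι₂)))))
    ; box-km1 = λ a → box-greatest λ b → ≤-trans (y≤x⇨y {x = b}) ι₂
    ; box-km2 = λ a → antisym (⋀-dense (allFin n) ⇨-eval) y≤x⇨y
    ; box-km3 = box-lower
    }

-- Sequents and canonical rules

-- Used twice: for `IPCK`, over which the finite closure is formed, and for derivability relative to
-- a sequent.
module Lindenbaum (⊢_ : Fm → Set) (⊢-mp : ∀ {φ ψ} → ⊢ φ → ⊢ (φ ⇒ ψ) → ⊢ ψ)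
                  (⊢-ipck : ∀ {φ} → IPCK φ → ⊢ φ) where

  _≤_ _≈_ : Fm → Fm → Set
  φ ≤ ψ = ⊢ (φ ⇒ ψ)
  φ ≈ ψ = φ ≤ ψ × ψ ≤ φ

  const : ∀ {φ ψ} → ⊢ ψ → φ ≤ ψ
  const p = ⊢-mp p (⊢-ipck (ax1 _ _))

  app : ∀ {φ ψ χ} → φ ≤ (ψ ⇒ χ) → φ ≤ ψ → φ ≤ χ
  app p q = ⊢-mp q (⊢-mp p (⊢-ipck (ax2 _ _ _)))

  ≤-refl′ : ∀ {φ} → φ ≤ φ
  ≤-refl′ {φ} = app {ψ = φ ⇒ φ} (⊢-ipck (ax1 _ _)) (⊢-ipck (ax1 _ _))

  ≤-trans′ : ∀ {φ ψ χ} → φ ≤ ψ → ψ ≤ χ → φ ≤ χ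
  ≤-trans′ p q = app (const q) p

  ∧-greatest′ : ∀ {φ ψ χ} → χ ≤ φ → χ ≤ ψ → χ ≤ (φ ∧' ψ)
  ∧-greatest′ p q = app (≤-trans′ p (⊢-ipck (ax5 _ _))) q

  curry′ : ∀ {φ ψ χ} → (φ ∧' ψ) ≤ χ → φ ≤ (ψ ⇒ χ)
  curry′ p = ≤-trans′ (⊢-ipck (ax5 _ _)) (⊢-mp (const p) (⊢-ipck (ax2 _ _ _)))

  algebra : HeytingAlgebra 0ℓ 0ℓ 0ℓ
  algebra = record
    { Carrier = Fm ; _≈_ = _≈_ ; _≤_ = _≤_
    ; _∨_ = _∨'_ ; _∧_ = _∧'_ ; _⇨_ = _⇒_ ; ⊤ = ⊤' ; ⊥ = ⊥'
    ; isHeytingAlgebra = record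
      { isBoundedLattice = record
        { isLattice = record
          { isPartialOrder = record
            { isPreorder = record
              { isEquivalence = record
                { refl  = ≤-refl′ , ≤-refl′
                ; sym   = λ (p , q) → q , p
                ; trans = λ (p , q) (r , s) → ≤-trans′ p r , ≤-trans′ s q
                }
              ; reflexive = proj₁
              ; trans     = ≤-trans′
              }
            ; antisym = _,_
            }
          ; supremum = λ φ ψ → ⊢-ipck (ax6 _ _) , ⊢-ipck (ax7 _ _) ,
                       λ χ p q → ⊢-mp q (⊢-mp p (⊢-ipck (ax8 _ _ _)))
          ; infimum = λ φ ψ → ⊢-ipck (ax3 _ _) , ⊢-ipck (ax4 _ _) , λ χ → ∧-greatest′
          }
        ; maximum = λ φ → const (⊢-ipck ax10)
        ; minimum = λ φ → ⊢-ipck (ax9 _)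
        }
      ; exponential = λ φ ψ χ → curry′ ,
          λ p → app (≤-trans′ (⊢-ipck (ax3 _ _)) p) (⊢-ipck (ax4 _ _))
      }
    }

  ⇔⇒≈ : ∀ {φ ψ} → ⊢ (φ ⇔ ψ) → φ ≈ ψ
  ⇔⇒≈ p = ⊢-mp p (⊢-ipck (ax3 _ _)) , ⊢-mp p (⊢-ipck (ax4 _ _))

  ≈⇒⇔ : ∀ {φ ψ} → φ ≈ ψ → ⊢ (φ ⇔ ψ)
  ≈⇒⇔ (p , q) = ⊢-mp q (⊢-mp p (⊢-ipck (ax5 _ _)))

  ⊢⇒⊤≤ : ∀ {φ} → ⊢ φ → ⊤' ≤ φ
  ⊢⇒⊤≤ = const

  ⊤≤⇒⊢ : ∀ {φ} → ⊤' ≤ φ → ⊢ φ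
  ⊤≤⇒⊢ = ⊢-mp (⊢-ipck ax10)

module Sequent {S : Pred Rule 0ℓ} (S-ext : InNExtKMR S) (Γ Δ : List Fm) where

  open InNExtKMR S-ext
  open IsMsiRuleSystem isMsiRuleSystem

  infix 2 ⊢_

  -- Keeping `Δ` on the right means that `⊢ φ` with `φ` in `Δ` derives the sequent, and that a
  -- derivation of the sequent yields every `⊢ φ`.
  ⊢_ : Fm → Set
  ⊢ φ = S (Γ / (φ ∷ Δ))

  ⊢-mp : ∀ {φ ψ} → ⊢ φ → ⊢ φ ⇒ ψ → ⊢ ψ
  ⊢-mp p q = cut (weaken id (∈-∷⁺ʳ (here refl) (there ∘ there)) p)
    (cut (weaken there (∈-∷⁺ʳ (here refl) (there ∘ there)) q)
         (weaken (∈-∷⁺ʳ (there (here refl)) (∈-∷⁺ʳ (here refl) (λ ()))) (∈-∷⁺ʳ (here refl) (λ ()))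
                 (modusPonens _ _)))

  ⊢-nec : ∀ {φ} → ⊢ φ → ⊢ ⊠ φ
  ⊢-nec p = cut (weaken id (∈-∷⁺ʳ (here refl) (there ∘ there)) p)
    (weaken (∈-∷⁺ʳ (here refl) (λ ())) (∈-∷⁺ʳ (here refl) (λ ())) (necessitation _))

  ⊢-ipck : ∀ {φ} → IPCK φ → ⊢ φ
  ⊢-ipck t = weaken (λ ()) (∈-∷⁺ʳ (here refl) (λ ())) (ipck _ t)

  ⊢-KM : ∀ {φ} → KM φ → ⊢ φ
  ⊢-KM t = weaken (λ ()) (∈-∷⁺ʳ (here refl) (λ ())) (extendsKMR _ (gen (_ , t , refl)))

  ⊢-hyp : ∀ {φ} → φ ∈ Γ → ⊢ φ
  ⊢-hyp φ∈Γ = weaken (∈-∷⁺ʳ φ∈Γ (λ ())) (∈-∷⁺ʳ (here refl) (λ ())) (refl' _)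

  ⊢-close : ∀ {φ} → φ ∈ Δ → ⊢ φ → S (Γ / Δ)
  ⊢-close φ∈Δ = weaken id (∈-∷⁺ʳ φ∈Δ id)

  open Lindenbaum ⊢_ ⊢-mp ⊢-ipck public
  open HeytingLemmas algebra public
  open HeytingAlgebra algebra public
    using (∧-greatest; ∨-least; maximum; minimum; transpose-⇨; transpose-∧; module Eq)

  ⊠-cong : ∀ {φ ψ} → φ ≈ ψ → ⊠ φ ≈ ⊠ ψ
  ⊠-cong (p , q) = ⊢-mp (⊢-nec p) (⊢-ipck (axK _ _)) , ⊢-mp (⊢-nec q) (⊢-ipck (axK _ _))

  instantiate : Fm → Fm → Subst
  instantiate φ ψ 0 = φ
  instantiate φ ψ _ = ψ

  ⊢-km1 : ∀ φ → φ ≤ ⊠ φ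
  ⊢-km1 φ = ⊢-KM (usub (instantiate φ φ) (axE km1))

  ⊢-km2 : ∀ φ → (⊠ φ ⇒ φ) ≤ φ
  ⊢-km2 φ = ⊢-KM (usub (instantiate φ φ) (axE km2))

  ⊢-km3 : ∀ φ ψ → ⊠ φ ≤ (ψ ∨' (ψ ⇒ φ))
  ⊢-km3 φ ψ = ⊢-KM (usub (instantiate φ ψ) (axE km3))

module _ {S : Pred Rule 0ℓ} (S-ext : InNExtKMR S) where

  open InNExtKMR S-ext
  open IsMsiRuleSystem isMsiRuleSystem

  cut-all : ∀ {Γ Δ Γ₁ Δ₁} → S (Γ₁ / Δ₁) →
            (∀ {γ} → γ ∈ Γ₁ → S (Γ / (γ ∷ Δ))) → (∀ {δ} → δ ∈ Δ₁ → S ((δ ∷ Γ) / Δ)) → S (Γ / Δ)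
  cut-all {Γ} {Δ} {Γ₁} {Δ₁} s = go Γ₁ Δ₁ (weaken ∈-++⁺ˡ ∈-++⁺ˡ s)
    where
    go : ∀ Γ₁ Δ₁ → S ((Γ₁ ++ Γ) / (Δ₁ ++ Δ)) →
         (∀ {γ} → γ ∈ Γ₁ → S (Γ / (γ ∷ Δ))) → (∀ {δ} → δ ∈ Δ₁ → S ((δ ∷ Γ) / Δ)) → S (Γ / Δ)
    go []       []       s f g = s
    go []       (δ ∷ Δ₁) s f g = go [] Δ₁
      (cut s (weaken id (∈-++⁺ʳ Δ₁) (g (here refl)))) (λ ()) (g ∘ there)
    go (γ ∷ Γ₁) Δ₁       s f g = go Γ₁ Δ₁
      (cut (weaken (∈-++⁺ʳ Γ₁) (∷⁺ʳ γ (∈-++⁺ʳ Δ₁)) (f (here refl))) s)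
      (f ∘ there) g

module CanonicalRule (d : PSCRData) where

  open PSCRData d
  open FiniteFronton H
  open Rule (ξ d)

  -- `P` and the lists below restate the local definitions of `ξ`, to name the blocks of its
  -- premises.
  P : Fin n → Fm
  P a = var (toℕ a)

  private
    els : List (Fin n)
    els = allFin n
    pairs : List (Fin n × Fin n)
    pairs = concatMap (λ a → map (λ b → (a , b)) els) els
    Γ∧ Γ∨ Γ⇨ Γ⊠ : List Fm
    Γ∧ = map (λ (a , b) → P (a ∧ b) ⇔ (P a ∧' P b)) pairs
    Γ∨ = map (λ (a , b) → P (a ∨ b) ⇔ (P a ∨' P b)) pairs
    Γ⇨ = map (λ (a , b) → P (a ⇨ b) ⇔ (P a ⇒ P b)) (filterᵇ (λ (a , b) → D→ a b) pairs)
    Γ⊠ = map (λ a → P (box a) ⇔ ⊠ (P a)) (filterᵇ D⊠ els)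

    ∈-pairs : ∀ a b → (a , b) ∈ pairs
    ∈-pairs a b = ∈-concatMap⁺ _ (lose (∈-allFin a) (∈-map⁺ _ (∈-allFin b)))

  data Premise : Fm → Set where
    bot-premise : Premise (P bot ⇔ ⊥')
    top-premise : Premise (P top ⇔ ⊤')
    ∧-premise   : ∀ a b → Premise (P (a ∧ b) ⇔ (P a ∧' P b))
    ∨-premise   : ∀ a b → Premise (P (a ∨ b) ⇔ (P a ∨' P b))
    ⇨-premise   : ∀ a b → D→ a b ≡ true → Premise (P (a ⇨ b) ⇔ (P a ⇒ P b))
    box-premise : ∀ a → D⊠ a ≡ true → Premise (P (box a) ⇔ ⊠ (P a))

  premise⁺ : ∀ {φ} → Premise φ → φ ∈ prem
  premise⁺ bot-premise       = here refl
  premise⁺ top-premise       = there (here refl)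
  premise⁺ (∧-premise a b)   = there (there (∈-++⁺ˡ (∈-map⁺ _ (∈-pairs a b))))
  premise⁺ (∨-premise a b)   = there (there (∈-++⁺ʳ Γ∧ (∈-++⁺ˡ (∈-map⁺ _ (∈-pairs a b)))))
  premise⁺ (⇨-premise a b p) = there (there (∈-++⁺ʳ Γ∧ (∈-++⁺ʳ Γ∨ (∈-++⁺ˡ
    (∈-map⁺ _ (∈-filter⁺ (T? ∘ λ (a , b) → D→ a b) (∈-pairs a b) (Equivalence.from T-≡ p)))))))
  premise⁺ (box-premise a p) = there (there (∈-++⁺ʳ Γ∧ (∈-++⁺ʳ Γ∨ (∈-++⁺ʳ Γ⇨
    (∈-map⁺ _ (∈-filter⁺ (T? ∘ D⊠) (∈-allFin a) (Equivalence.from T-≡ p)))))))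

  premise⁻ : ∀ {φ} → φ ∈ prem → Premise φ
  premise⁻ (here refl)         = bot-premise
  premise⁻ (there (here refl)) = top-premise
  premise⁻ (there (there φ∈)) =
    [ from-∧ , [ from-∨ , [ from-⇨ , from-⊠ ]′ ∘ ∈-++⁻ Γ⇨ ]′ ∘ ∈-++⁻ Γ∨ ]′ (∈-++⁻ Γ∧ φ∈)
    where
    from-∧ : ∀ {φ} → φ ∈ Γ∧ → Premise φ
    from-∧ φ∈ with ∈-map⁻ _ φ∈
    ... | (a , b) , _ , refl = ∧-premise a b
    from-∨ : ∀ {φ} → φ ∈ Γ∨ → Premise φ
    from-∨ φ∈ with ∈-map⁻ _ φ∈
    ... | (a , b) , _ , refl = ∨-premise a b
    from-⇨ : ∀ {φ} → φ ∈ Γ⇨ → Premise φ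
    from-⇨ φ∈ with ∈-map⁻ _ φ∈
    ... | (a , b) , ab∈ , refl = ⇨-premise a b (Equivalence.to T-≡
      (proj₂ (∈-filter⁻ (T? ∘ λ (a , b) → D→ a b) {xs = pairs} ab∈)))
    from-⊠ : ∀ {φ} → φ ∈ Γ⊠ → Premise φ
    from-⊠ φ∈ with ∈-map⁻ _ φ∈
    ... | a , a∈ , refl = box-premise a (Equivalence.to T-≡
      (proj₂ (∈-filter⁻ (T? ∘ D⊠) {xs = els} a∈)))

  conclusion⁺ : ∀ {a b} → a ≢ b → (P a ⇔ P b) ∈ concl
  conclusion⁺ {a} {b} a≢b = ∈-concatMap⁺ _ (lose (∈-pairs a b) ab∈)
    where
    ab∈ : (P a ⇔ P b) ∈ (if does (a ≟ b) then [] else [ P a ⇔ P b ])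
    ab∈ with a ≟ b
    ... | yes a≡b = contradiction a≡b a≢b
    ... | no  _   = here refl

  conclusion⁻ : ∀ {φ} → φ ∈ concl → ∃ λ a → ∃ λ b → a ≢ b × φ ≡ (P a ⇔ P b)
  conclusion⁻ φ∈ with find
    (∈-concatMap⁻ (λ (a , b) → if does (a ≟ b) then [] else [ P a ⇔ P b ]) {xs = pairs} φ∈)
  ... | (a , b) , _ , φ∈ with a ≟ b | φ∈
  ...   | no a≢b | here refl = a , b , a≢b , refl

  cut-canonical-rule : ∀ {S : Pred Rule 0ℓ} (S-ext : InNExtKMR S) {Γ Δ} (σ : Subst) →
    (∀ {γ} → Premise γ → S (Γ / (sub σ γ ∷ Δ))) →
    (∀ {a b} → a ≢ b → S ((sub σ (P a ⇔ P b) ∷ Γ) / Δ)) →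
    S (ξ d) → S (Γ / Δ)
  cut-canonical-rule {S} S-ext {Γ} {Δ} σ f g s =
    cut-all S-ext (structural σ s) from-premise from-conclusion
    where
    open InNExtKMR S-ext
    open IsMsiRuleSystem isMsiRuleSystem
    from-premise : ∀ {γ} → γ ∈ map (sub σ) prem → S (Γ / (γ ∷ Δ))
    from-premise γ∈ with ∈-map⁻ (sub σ) γ∈
    ... | _ , γ∈ , refl = f (premise⁻ γ∈)
    from-conclusion : ∀ {δ} → δ ∈ map (sub σ) concl → S ((δ ∷ Γ) / Δ)
    from-conclusion δ∈ with ∈-map⁻ (sub σ) δ∈
    ... | _ , δ∈ , refl with conclusion⁻ δ∈
    ...   | _ , _ , a≢b , refl = g a≢b

-- Refutations and the derivation of canonical rules from a refuted rule

subformulas : Fm → List Fm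
subformulas φ@(var _)  = φ ∷ []
subformulas φ@(α ∧' β) = φ ∷ subformulas α ++ subformulas β
subformulas φ@(α ∨' β) = φ ∷ subformulas α ++ subformulas β
subformulas φ@(α ⇒ β)  = φ ∷ subformulas α ++ subformulas β
subformulas φ@(⊠ α)    = φ ∷ subformulas α
subformulas φ@⊥'       = φ ∷ []
subformulas φ@⊤'       = φ ∷ []

self∈subformulas : ∀ φ → φ ∈ subformulas φ
self∈subformulas (var _)  = here refl
self∈subformulas (_ ∧' _) = here refl
self∈subformulas (_ ∨' _) = here refl
self∈subformulas (_ ⇒ _)  = here refl
self∈subformulas (⊠ _)    = here refl
self∈subformulas ⊥'       = here refl
self∈subformulas ⊤'       = here refl

module Valuation (H : FiniteFronton) (V : ℕ → Fin (FiniteFronton.n H)) where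

  open FiniteFronton H

  eval : Fm → Fin n
  eval (var x)  = V x
  eval (φ ∧' ψ) = eval φ ∧ eval ψ
  eval (φ ∨' ψ) = eval φ ∨ eval ψ
  eval (φ ⇒ ψ)  = eval φ ⇨ eval ψ
  eval (⊠ φ)    = box (eval φ)
  eval ⊥'       = bot
  eval ⊤'       = top

-- `D→` and `D⊠` must contain the arguments of the implications and boxes in `G`, but may be larger:
-- `D-ok` forces further pairs into `D→`.
record Refutes (d : PSCRData) (r : Rule) : Set where
  open PSCRData d
  open FiniteFronton H
  open Rule r
  field
    V : ℕ → Fin n
  open Valuation H V public
  field
    G           : List Fm
    prem-sub    : ∀ {φ} → φ ∈ prem → subformulas φ ⊆ G
    concl-sub   : ∀ {φ} → φ ∈ concl → subformulas φ ⊆ G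
    D→-G        : ∀ {φ ψ} → (φ ⇒ ψ) ∈ G → D→ (eval φ) (eval ψ) ≡ true
    D⊠-G        : ∀ {φ} → ⊠ φ ∈ G → D⊠ (eval φ) ≡ true
    prem-true   : ∀ {φ} → φ ∈ prem → eval φ ≡ top
    concl-false : ∀ {φ} → φ ∈ concl → eval φ ≢ top

module Refutation {S : Pred Rule 0ℓ} (S-ext : InNExtKMR S) {d : PSCRData} {r : Rule}
                  (refutes : Refutes d r) where

  open PSCRData d
  open FiniteFronton H
  open Refutes refutes
  open CanonicalRule d
  open Rule (ξ d)

  σ : Subst
  σ = P ∘ V

  module _ (Γ Δ : List Fm) (prem⊆Γ : prem ⊆ Γ) where

    open Sequent S-ext Γ Δ

    ⊢-premise : ∀ {φ ψ} → Premise (φ ⇔ ψ) → φ ≈ ψ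
    ⊢-premise = ⇔⇒≈ ∘ ⊢-hyp ∘ prem⊆Γ ∘ premise⁺

    -- The premises of `ξ d` describe `⇨` and `box` only on `D→` and `D⊠`; this suffices for
    -- formulas whose subformulas lie in `G`.
    eval-correct : ∀ φ → subformulas φ ⊆ G → P (eval φ) ≈ sub σ φ
    eval-correct (var x)  sub⊆ = Eq.refl
    eval-correct (α ∧' β) sub⊆ = Eq.trans (⊢-premise (∧-premise _ _))
      (∧-cong (eval-correct α (sub⊆ ∘ there ∘ ∈-++⁺ˡ))
              (eval-correct β (sub⊆ ∘ there ∘ ∈-++⁺ʳ (subformulas α))))
    eval-correct (α ∨' β) sub⊆ = Eq.trans (⊢-premise (∨-premise _ _))
      (∨-cong (eval-correct α (sub⊆ ∘ there ∘ ∈-++⁺ˡ))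
              (eval-correct β (sub⊆ ∘ there ∘ ∈-++⁺ʳ (subformulas α))))
    eval-correct (α ⇒ β)  sub⊆ = Eq.trans (⊢-premise (⇨-premise _ _ (D→-G (sub⊆ (here refl)))))
      (⇨-cong (eval-correct α (sub⊆ ∘ there ∘ ∈-++⁺ˡ))
              (eval-correct β (sub⊆ ∘ there ∘ ∈-++⁺ʳ (subformulas α))))
    eval-correct (⊠ α)    sub⊆ = Eq.trans (⊢-premise (box-premise _ (D⊠-G (sub⊆ (here refl)))))
      (⊠-cong (eval-correct α (sub⊆ ∘ there)))
    eval-correct ⊥'       sub⊆ = ⊢-premise bot-premise
    eval-correct ⊤'       sub⊆ = ⊢-premise top-premise

  -- Substituted premises of `r` are equivalent to `P top`, hence derivable. Assuming a substituted
  -- conclusion `δ` makes `P (eval δ)` equivalent to `P top`, which is a conclusion of `ξ d` since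
  -- `eval δ` is not `top`.
  canonical-rule-derivable : S r → S (ξ d)
  canonical-rule-derivable s =
    cut-all S-ext (structural σ s) from-premise from-conclusion
    where
    open InNExtKMR S-ext
    open IsMsiRuleSystem isMsiRuleSystem
    from-premise : ∀ {γ} → γ ∈ map (sub σ) (Rule.prem r) → S (prem / (γ ∷ concl))
    from-premise γ∈ with ∈-map⁻ (sub σ) γ∈
    ... | γ , γ∈Γ , refl = ⊤≤⇒⊢ (proj₁ (Eq.trans
        (Eq.sym (⊢-premise prem concl id top-premise))
        (subst (λ i → P i ≈ sub σ γ) (prem-true γ∈Γ) (eval-correct prem concl id γ (prem-sub γ∈Γ)))))
      where open Sequent S-ext prem concl
    from-conclusion : ∀ {δ} → δ ∈ map (sub σ) (Rule.concl r) → S ((δ ∷ prem) / concl)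
    from-conclusion δ∈ with ∈-map⁻ (sub σ) δ∈
    ... | δ , δ∈Δ , refl = ⊢-close (conclusion⁺ (concl-false δ∈Δ)) (≈⇒⇔ (Eq.trans
        (eval-correct Γ′ concl there δ (concl-sub δ∈Δ))
        (Eq.trans (maximum _ , ⊢⇒⊤≤ (⊢-hyp (here refl)))
                  (Eq.sym (⊢-premise Γ′ concl there top-premise)))))
      where
      Γ′ = sub σ δ ∷ prem
      open Sequent S-ext Γ′ concl

-- The finite algebra presented by a saturated sequent

-- Greedy choice: `x` is kept if it is separated from all representatives already chosen, and
-- otherwise is related to one of them.
representatives : {R : Rel A ℓ₁} {N : Rel A ℓ₂} (xs : List A) → (∀ {x} → R x x) →
  (∀ {x y} → x ∈ xs → y ∈ xs → N x y ⊎ R x y) →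
  ∃ λ ys → ys ⊆ xs × (∀ {x} → x ∈ xs → ∃ λ y → y ∈ ys × R x y) × AllPairs N ys
representatives []       R-refl decide = [] , id , (λ ()) , []
representatives (x ∷ xs) R-refl decide
  with representatives xs R-refl (λ x∈ y∈ → decide (there x∈) (there y∈))
... | ys , ys⊆xs , cover , pairs
  with all⊎any (λ y∈ys → decide (here refl) (there (ys⊆xs y∈ys)))
...   | inj₁ new = x ∷ ys
  , (λ { (here refl) → here refl ; (there y∈) → there (ys⊆xs y∈) })
  , (λ { (here refl) → x , here refl , R-refl
       ; (there z∈) → let y , y∈ , r = cover z∈ in y , there y∈ , r })
  , tabulate new ∷ pairs
...   | inj₂ (y , y∈ys , r) = ys , there ∘ ys⊆xs
  , (λ { (here refl) → y , y∈ys , r ; (there z∈) → cover z∈ }) , pairs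

-- Total on `ℕ`, so that `nth φs` is a substitution; the variables of the canonical rule have
-- indices below `length φs` and never reach the default.
nth : List Fm → ℕ → Fm
nth []       _       = ⊤'
nth (φ ∷ φs) zero    = φ
nth (φ ∷ φs) (suc i) = nth φs i

nth-∈ : ∀ φs (i : Fin (length φs)) → nth φs (toℕ i) ∈ φs
nth-∈ (φ ∷ φs) zero    = here refl
nth-∈ (φ ∷ φs) (suc i) = there (nth-∈ φs i)

nth-surjective : ∀ {φ} φs → φ ∈ φs → ∃ λ (i : Fin (length φs)) → nth φs (toℕ i) ≡ φ
nth-surjective (φ ∷ φs) (here refl) = zero , refl
nth-surjective (φ ∷ φs) (there φ∈)  = let i , eq = nth-surjective φs φ∈ in suc i , eq

nth-AllPairs : {N : Rel Fm ℓ₁} (φs : List Fm) → AllPairs N φs → (i j : Fin (length φs)) → i ≢ j →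
               N (nth φs (toℕ i)) (nth φs (toℕ j)) ⊎ N (nth φs (toℕ j)) (nth φs (toℕ i))
nth-AllPairs (φ ∷ φs) (p ∷ ps) zero    zero    i≢j = contradiction refl i≢j
nth-AllPairs (φ ∷ φs) (p ∷ ps) zero    (suc j) i≢j = inj₁ (lookupAll p (nth-∈ φs j))
nth-AllPairs (φ ∷ φs) (p ∷ ps) (suc i) zero    i≢j = inj₂ (lookupAll p (nth-∈ φs i))
nth-AllPairs (φ ∷ φs) (p ∷ ps) (suc i) (suc j) i≢j = nth-AllPairs φs ps i j (i≢j ∘ cong suc)

∀Fin⊎ : ∀ {n} {P : Fin n → Set a} → (∀ i → P i ⊎ C) → (∀ i → P i) ⊎ C
∀Fin⊎ f with all⊎any {xs = allFin _} (λ {i} _ → f i)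
... | inj₁ p           = inj₁ (λ i → p (∈-allFin i))
... | inj₂ (_ , _ , c) = inj₂ c

-- The hypothesis is decidable, so the escape `C` can be pulled out of the implication.
T→⊎ : ∀ b → (T b → X ⊎ C) → (T b → X) ⊎ C
T→⊎ false f = inj₁ λ ()
T→⊎ true  f = [ (λ x → inj₁ λ _ → x) , inj₂ ]′ (f _)

infixr 4 _⊗_

_⊗_ : X ⊎ C → Y ⊎ C → (X × Y) ⊎ C
inj₁ x ⊗ inj₁ y = inj₁ (x , y)
inj₁ _ ⊗ inj₂ c = inj₂ c
inj₂ c ⊗ _      = inj₂ c

subformulas-trans : ∀ {φ} ψ → φ ∈ subformulas ψ → subformulas φ ⊆ subformulas ψ
subformulas-trans₂ : ∀ {φ} α β → φ ∈ subformulas α ++ subformulas β →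
                     subformulas φ ⊆ subformulas α ++ subformulas β
subformulas-trans₂ α β φ∈ =
  [ (λ φ∈α → ∈-++⁺ˡ ∘ subformulas-trans α φ∈α)
  , (λ φ∈β → ∈-++⁺ʳ (subformulas α) ∘ subformulas-trans β φ∈β) ]′ (∈-++⁻ (subformulas α) φ∈)
subformulas-trans ψ@(var _)  (here refl) = id
subformulas-trans ψ@(α ∧' β) (here refl) = id
subformulas-trans ψ@(α ∧' β) (there φ∈)  = there ∘ subformulas-trans₂ α β φ∈
subformulas-trans ψ@(α ∨' β) (here refl) = id
subformulas-trans ψ@(α ∨' β) (there φ∈)  = there ∘ subformulas-trans₂ α β φ∈
subformulas-trans ψ@(α ⇒ β)  (here refl) = id
subformulas-trans ψ@(α ⇒ β)  (there φ∈)  = there ∘ subformulas-trans₂ α β φ∈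
subformulas-trans ψ@(⊠ α)    (here refl) = id
subformulas-trans ψ@(⊠ α)    (there φ∈)  = there ∘ subformulas-trans α φ∈
subformulas-trans ψ@⊥'       (here refl) = id
subformulas-trans ψ@⊤'       (here refl) = id

var? : ∀ x φ → Dec (var x ≡ φ)
var? x (var y) with x ℕ.≟ y
... | yes refl = yes refl
... | no  x≢y  = no λ { refl → x≢y refl }
var? x (_ ∧' _) = no λ ()
var? x (_ ∨' _) = no λ ()
var? x (_ ⇒ _)  = no λ ()
var? x (⊠ _)    = no λ ()
var? x ⊥'       = no λ ()
var? x ⊤'       = no λ ()

boxArg : Fm → List Fm
boxArg (⊠ φ) = [ φ ]
boxArg _     = []

∈-boxArg : ∀ {φ} ψ → φ ∈ boxArg ψ → ψ ≡ ⊠ φ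
∈-boxArg (⊠ φ) (here refl) = refl

impArgs : Fm → List (Fm × Fm)
impArgs (φ ⇒ ψ) = [ φ , ψ ]
impArgs _       = []

∈-impArgs : ∀ {φ ψ} χ → (φ , ψ) ∈ impArgs χ → χ ≡ (φ ⇒ ψ)
∈-impArgs (φ ⇒ ψ) (here refl) = refl

does-true : (X? : Dec X) → does X? ≡ true → X
does-true (yes x) _ = x

or-true : ∀ a {b} → a or b ≡ true → a ≡ true ⊎ b ≡ true
or-true true  _ = inj₁ refl
or-true false p = inj₂ p

-- PSCRData lives in Set₁; the index type of an axiomatisation must be a Set.
record Code : Set where
  field
    𝕃 : FiniteDistributiveLattice
  open FiniteDistributiveLattice 𝕃
  field
    D→   : Fin n → Fin n → Bool
    D⊠   : Fin n → Bool
    D-ok : ∀ a → D⊠ a ≡ true → ∀ b → D→ b a ≡ true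

⟦_⟧ : Code → PSCRData
⟦ c ⟧ = record { H = FiniteHeyting.fronton 𝕃 ; D→ = D→ ; D⊠ = D⊠ ; D-ok = D-ok }
  where open Code c

module Representatives {S : Pred Rule 0ℓ} (S-ext : InNExtKMR S) {Γ Δ : List Fm} (F : List Fm)
  (decided : ∀ {φ ψ} → φ ∈ F → ψ ∈ F → (φ ⇒ ψ) ∈ Γ ⊎ (φ ⇒ ψ) ∈ Δ)
  where

  open Sequent S-ext Γ Δ

  -- A positive form of inequivalence: proving the implication found in `Δ` derives the sequent.
  Separated : Fm → Fm → Set
  Separated φ ψ = (φ ⇒ ψ) ∈ Δ ⊎ (ψ ⇒ φ) ∈ Δ

  separated⊎≈ : ∀ {φ ψ} → φ ∈ F → ψ ∈ F → Separated φ ψ ⊎ φ ≈ ψ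
  separated⊎≈ φ∈ ψ∈ with decided φ∈ ψ∈ | decided ψ∈ φ∈
  ... | inj₂ p | _      = inj₁ (inj₁ p)
  ... | inj₁ _ | inj₂ q = inj₁ (inj₂ q)
  ... | inj₁ p | inj₁ q = inj₂ (⊢-hyp p , ⊢-hyp q)

  reps : ∃ λ φs → φs ⊆ F × (∀ {φ} → φ ∈ F → ∃ λ ψ → ψ ∈ φs × φ ≈ ψ) × AllPairs Separated φs
  reps = representatives F Eq.refl separated⊎≈

  φs : List Fm
  φs = proj₁ reps

  n : ℕ
  n = length φs

  rep : Fin n → Fm
  rep i = nth φs (toℕ i)

  rep-∈ : ∀ i → rep i ∈ F
  rep-∈ i = proj₁ (proj₂ reps) (nth-∈ φs i)

  rep-separated : ∀ {i j} → i ≢ j → Separated (rep i) (rep j)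
  rep-separated {i} {j} i≢j =
    [ id , [ inj₂ , inj₁ ]′ ]′ (nth-AllPairs φs (proj₂ (proj₂ (proj₂ reps))) i j i≢j)

  rep-index : ∀ {φ} → φ ∈ F → ∃ λ i → rep i ≈ φ
  rep-index {φ} φ∈ =
    let ψ , ψ∈ , φ≈ψ = proj₁ (proj₂ (proj₂ reps)) φ∈
        i , eq = nth-surjective φs ψ∈
    in i , subst (_≈ φ) (sym eq) (Eq.sym φ≈ψ)

  -- Reads off the side of the sequent on which the implication occurs, and so is computable
  -- although derivability is not decidable.
  leq : Fin n → Fin n → Bool
  leq i j = [ (λ _ → true) , (λ _ → false) ]′ (decided (rep-∈ i) (rep-∈ j))

  leq-sound : ∀ {i j} → T (leq i j) → rep i ≤ rep j
  leq-sound {i} {j} i≤j with decided (rep-∈ i) (rep-∈ j)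
  ... | inj₁ p = ⊢-hyp p

  leq-complete : ∀ {i j} → rep i ≤ rep j → T (leq i j) ⊎ S (Γ / Δ)
  leq-complete {i} {j} i≤j with decided (rep-∈ i) (rep-∈ j)
  ... | inj₁ _ = inj₁ _
  ... | inj₂ p = inj₂ (⊢-close p i≤j)

module _ {S : Pred Rule 0ℓ} (S-ext : InNExtKMR S) where

  open InNExtKMR S-ext
  open IsMsiRuleSystem isMsiRuleSystem

  -- Each cut on `φ` puts it on the right in one branch and on the left in the other, so at the
  -- leaves all of `Φ` is decided.
  split : ∀ Φ {Γ Δ} →
    (∀ {Γ′ Δ′} → Γ ⊆ Γ′ → Δ ⊆ Δ′ → (∀ {φ} → φ ∈ Φ → φ ∈ Γ′ ⊎ φ ∈ Δ′) → S (Γ′ / Δ′)) → S (Γ / Δ)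
  split []      f = f id id λ ()
  split (φ ∷ Φ) f = cut
    (split Φ λ Γ⊆ Δ⊆ d → f Γ⊆ (Δ⊆ ∘ there) λ { (here refl) → inj₂ (Δ⊆ (here refl)) ; (there p) → d p })
    (split Φ λ Γ⊆ Δ⊆ d → f (Γ⊆ ∘ there) Δ⊆ λ { (here refl) → inj₁ (Γ⊆ (here refl)) ; (there p) → d p })

-- Recovering a rule from its canonical rules

module Decomposition (r : Rule) where

  open Rule r

  G : List Fm
  G = concatMap subformulas (prem ++ concl)

  D : List Fm
  D = concatMap boxArg G

  rule-sub : ∀ {φ} → φ ∈ prem ++ concl → subformulas φ ⊆ G
  rule-sub φ∈ ψ∈ = ∈-concatMap⁺ _ (lose φ∈ ψ∈)

  G-sub : ∀ {φ} → φ ∈ G → subformulas φ ⊆ G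
  G-sub φ∈ with find (∈-concatMap⁻ subformulas {xs = prem ++ concl} φ∈)
  ... | χ , χ∈ , φ∈χ = rule-sub χ∈ ∘ subformulas-trans χ φ∈χ

  ⊠∈G⇒∈D : ∀ {φ} → ⊠ φ ∈ G → φ ∈ D
  ⊠∈G⇒∈D ⊠φ∈ = ∈-concatMap⁺ _ (lose ⊠φ∈ (here refl))

  ∈D⇒⊠∈G : ∀ {φ} → φ ∈ D → ⊠ φ ∈ G
  ∈D⇒⊠∈G φ∈ with find (∈-concatMap⁻ boxArg {xs = G} φ∈)
  ... | χ , χ∈ , φ∈χ with ∈-boxArg χ φ∈χ
  ...   | refl = χ∈

  D⊆G : D ⊆ G
  D⊆G {φ} φ∈ = G-sub (∈D⇒⊠∈G φ∈) (there (self∈subformulas φ))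

  ∈impArgs⇒⇒∈G : ∀ {φ ψ} → (φ , ψ) ∈ concatMap impArgs G → (φ ⇒ ψ) ∈ G
  ∈impArgs⇒⇒∈G φψ∈ with find (∈-concatMap⁻ impArgs {xs = G} φψ∈)
  ... | χ , χ∈ , φψ∈χ with ∈-impArgs χ φψ∈χ
  ...   | refl = χ∈

  -- The closure is formed before any sequent is given, because the cuts that saturate the sequent
  -- range over it. Equivalences in `IPCK` hold relative to every sequent.
  open Lindenbaum IPCK mp id using () renaming (algebra to IPCK-algebra)
  open RelativeImplicationClosure IPCK-algebra G D D⊆G

  module _ {S : Pred Rule 0ℓ} (S-ext : InNExtKMR S) {Γ Δ : List Fm} (σ : Subst) (n : ℕ) where

    open InNExtKMR S-ext
    open IsMsiRuleSystem isMsiRuleSystem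
    open Sequent S-ext Γ Δ

    -- Defined through `σ` so that `sub σ (P a)` unfolds to `rep a`.
    rep : Fin n → Fm
    rep i = σ (toℕ i)

    module Quotient
      (prem⊆Γ : prem ⊆ Γ) (concl⊆Δ : concl ⊆ Δ)
      (canonical : ∀ c → Refutes ⟦ c ⟧ r → S (ξ ⟦ c ⟧))
      (rep-∈ : ∀ i → rep i ∈ closure)
      (F-index : ∀ {φ} → φ ∈ closure → ∃ λ i → rep i ≈ φ)
      (rep-separated : ∀ {i j} → i ≢ j → (rep i ⇒ rep j) ∈ Δ ⊎ (rep j ⇒ rep i) ∈ Δ)
      (leq : Fin n → Fin n → Bool)
      (leq-sound : ∀ {i j} → T (leq i j) → rep i ≤ rep j)
      (leq-complete : ∀ {i j} → rep i ≤ rep j → T (leq i j) ⊎ S (Γ / Δ))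
      where

      absorb : ∀ {φ} → ⊢ φ ⊎ S (Γ / Δ) → ⊢ φ
      absorb = [ id , weaken id there ]′

      leq→⊎ : ∀ {i j} → (T (leq i j) → X ⊎ C) → (T (leq i j) → X) ⊎ C
      leq→⊎ {i = i} {j} = T→⊎ (leq i j)

      leq-antisym : ∀ {i j} → T (leq i j) → T (leq j i) → i ≡ j ⊎ S (Γ / Δ)
      leq-antisym {i} {j} i≤j j≤i with i ≟ j
      ... | yes i≡j = inj₁ i≡j
      ... | no  i≢j = inj₂ ([ (λ p → ⊢-close p (leq-sound i≤j)) , (λ p → ⊢-close p (leq-sound j≤i)) ]′
                            (rep-separated i≢j))

      rep-index : ∀ {φ} → φ ∈≈ closure → ∃ λ i → rep i ≈ φ
      rep-index (χ , χ∈ , φ≤χ , χ≤φ) =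
        let i , i≈χ = F-index χ∈ in i , Eq.trans i≈χ (⊢-ipck χ≤φ , ⊢-ipck φ≤χ)

      ∧-index : ∀ i j → ∃ λ k → rep k ≈ (rep i ∧' rep j)
      ∧-index i j = rep-index (sublattice-∧ generators (rep-∈ i) (rep-∈ j))

      ∨-index : ∀ i j → ∃ λ k → rep k ≈ (rep i ∨' rep j)
      ∨-index i j = rep-index (sublattice-∨ generators (rep-∈ i) (rep-∈ j))

      top-index : ∃ λ k → rep k ≈ ⊤'
      top-index = rep-index (sublattice-⊤ generators)

      bot-index : ∃ λ k → rep k ≈ ⊥'
      bot-index = rep-index (sublattice-⊥ generators)

      _∧_ _∨_ : Fin n → Fin n → Fin n
      i ∧ j = proj₁ (∧-index i j)
      i ∨ j = proj₁ (∨-index i j)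

      top bot : Fin n
      top = proj₁ top-index
      bot = proj₁ bot-index

      rep-∧ : ∀ {i j} → rep (i ∧ j) ≈ (rep i ∧' rep j)
      rep-∧ {i} {j} = proj₂ (∧-index i j)

      rep-∨ : ∀ {i j} → rep (i ∨ j) ≈ (rep i ∨' rep j)
      rep-∨ {i} {j} = proj₂ (∨-index i j)

      -- All laws are bundled for one triple, so that a single search either establishes them or
      -- derives the sequent.
      Laws : Fin n → Fin n → Fin n → Set
      Laws i j k =
        T (leq i i) × (T (leq i j) → T (leq j k) → T (leq i k)) × (T (leq i j) → T (leq j i) → i ≡ j) ×
        T (leq i (i ∨ j)) × T (leq j (i ∨ j)) × (T (leq i k) → T (leq j k) → T (leq (i ∨ j) k)) ×
        T (leq (i ∧ j) i) × T (leq (i ∧ j) j) × (T (leq k i) → T (leq k j) → T (leq k (i ∧ j))) ×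
        T (leq i top) × T (leq bot i) × T (leq (i ∧ (j ∨ k)) ((i ∧ j) ∨ (i ∧ k)))

      laws⊎ : (∀ i j k → Laws i j k) ⊎ S (Γ / Δ)
      laws⊎ = ∀Fin⊎ λ i → ∀Fin⊎ λ j → ∀Fin⊎ λ k →
          leq-complete ≤-refl
        ⊗ (leq→⊎ λ p → leq→⊎ λ q → leq-complete (≤-trans (leq-sound p) (leq-sound q)))
        ⊗ (leq→⊎ λ p → leq→⊎ λ q → leq-antisym p q)
        ⊗ leq-complete (≤-trans ι₁ (proj₂ rep-∨))
        ⊗ leq-complete (≤-trans ι₂ (proj₂ rep-∨))
        ⊗ (leq→⊎ λ p → leq→⊎ λ q →
            leq-complete (≤-trans (proj₁ rep-∨) (∨-least (leq-sound p) (leq-sound q))))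
        ⊗ leq-complete (≤-trans (proj₁ rep-∧) π₁)
        ⊗ leq-complete (≤-trans (proj₁ rep-∧) π₂)
        ⊗ (leq→⊎ λ p → leq→⊎ λ q →
            leq-complete (≤-trans (∧-greatest (leq-sound p) (leq-sound q)) (proj₂ rep-∧)))
        ⊗ leq-complete (≤-trans (maximum _) (proj₂ (proj₂ top-index)))
        ⊗ leq-complete (≤-trans (proj₁ (proj₂ bot-index)) (minimum _))
        ⊗ leq-complete (≤-trans (proj₁ (Eq.trans rep-∧ (∧-cong Eq.refl rep-∨)))
            (≤-trans (∧-distribˡ-∨-≤ _ _ _) (proj₂ (Eq.trans rep-∨ (∨-cong rep-∧ rep-∧)))))

      module _ (laws : ∀ i j k → Laws i j k) where

        isBoundedLattice : IsBoundedLattice _≡_ (λ i j → T (leq i j)) _∨_ _∧_ top bot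
        isBoundedLattice = record
          { isLattice = record
            { isPartialOrder = record
              { isPreorder = record
                { isEquivalence = isEquivalence
                ; reflexive = λ { {i} refl → let p , _ = laws i i i in p }
                ; trans = λ {i} {j} {k} → let _ , p , _ = laws i j k in p
                }
              ; antisym = λ {i} {j} → let _ , _ , p , _ = laws i j j in p
              }
            ; supremum = λ i j →
                (let _ , _ , _ , p , _ = laws i j j in p) ,
                (let _ , _ , _ , _ , p , _ = laws i j j in p) ,
                λ k → let _ , _ , _ , _ , _ , p , _ = laws i j k in p
            ; infimum = λ i j →
                (let _ , _ , _ , _ , _ , _ , p , _ = laws i j j in p) ,
                (let _ , _ , _ , _ , _ , _ , _ , p , _ = laws i j j in p) ,
                λ k → let _ , _ , _ , _ , _ , _ , _ , _ , p , _ = laws i j k in p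
            }
          ; maximum = λ i → let _ , _ , _ , _ , _ , _ , _ , _ , _ , p , _ = laws i i i in p
          ; minimum = λ i → let _ , _ , _ , _ , _ , _ , _ , _ , _ , _ , p , _ = laws i i i in p
          }

        𝕃 : FiniteDistributiveLattice
        𝕃 = record
          { isBoundedLattice = isBoundedLattice
          ; distrib = λ i j k → let _ , _ , _ , _ , _ , _ , _ , _ , _ , _ , _ , p = laws i j k in p
          }

        private
          module ℍ = FiniteHeyting 𝕃
          module ℍ-Heyting = HeytingAlgebra ℍ.heytingAlgebra
          module ℍ-Lemmas = HeytingLemmas ℍ.heytingAlgebra
        open ℍ using (_⇨_; box)

        -- `i ⇨ j` always lies below the formula `rep i ⇒ rep j`. If some `k` represents that
        -- formula, then `k ∧ i` is below `j`, which puts `k` below `i ⇨ j`.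
        rep-⇨ : ∀ {i j k} → rep k ≈ (rep i ⇒ rep j) → rep (i ⇨ j) ≈ (rep i ⇒ rep j)
        rep-⇨ {i} {j} {k} (k≤ , ≤k) =
          transpose-⇨ (≤-trans (proj₂ rep-∧) (leq-sound (ℍ-Lemmas.⇨-eval {i} {j}))) ,
          absorb ([ (λ k∧i≤j → inj₁ (≤-trans ≤k (leq-sound (ℍ-Heyting.transpose-⇨ {k} {i} {j} k∧i≤j)))) , inj₂ ]′
            (leq-complete (≤-trans (proj₁ rep-∧) (transpose-∧ k≤))))

        -- The factor at `b = k` of `box a` reads `⊠ (rep a) ∨' (⊠ (rep a) ⇒ rep a)`, which is below
        -- `⊠ (rep a)` by the axioms `km2` and `km1`. Conversely `km3` puts `⊠ (rep a)` below every
        -- factor. Both directions read the factors through `imp-a`.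
        rep-box : ∀ {a k} → rep k ≈ ⊠ (rep a) → (∀ b → rep (b ⇨ a) ≈ (rep b ⇒ rep a)) →
                  rep (box a) ≈ ⊠ (rep a)
        rep-box {a} {k} (k≤ , ≤k) imp-a = box≤ , absorb ≤box
          where
          rep-∨⇨ : ∀ b → rep (b ∨ (b ⇨ a)) ≈ (rep b ∨' (rep b ⇒ rep a))
          rep-∨⇨ b = Eq.trans rep-∨ (∨-cong Eq.refl (imp-a b))
          box≤ : rep (box a) ≤ ⊠ (rep a)
          box≤ = ≤-trans (leq-sound (ℍ.box-lower a k)) (≤-trans (proj₁ (rep-∨⇨ k))
            (∨-least k≤ (≤-trans (⇨ˡ-contravariant ≤k) (≤-trans (⊢-km2 _) (⊢-km1 _)))))
          ≤box : (⊠ (rep a) ≤ rep (box a)) ⊎ S (Γ / Δ)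
          ≤box = [ (λ k≤all → inj₁ (≤-trans ≤k (leq-sound (ℍ.box-greatest k≤all)))) , inj₂ ]′
            (∀Fin⊎ λ b → leq-complete (≤-trans k≤ (≤-trans (⊢-km3 _ _) (proj₂ (rep-∨⇨ b)))))

        index-of-var : ∀ {x} → Dec (var x ∈ G) → Fin n
        index-of-var (yes x∈G) = proj₁ (rep-index (closure-gen x∈G))
        -- Such a variable does not occur in `r`, so its value is arbitrary.
        index-of-var (no  _)   = top

        rep-index-of-var : ∀ {x} (x∈G? : Dec (var x ∈ G)) → var x ∈ G → rep (index-of-var x∈G?) ≈ var x
        rep-index-of-var (yes x∈G) _   = proj₂ (rep-index (closure-gen x∈G))
        rep-index-of-var (no  x∉G) x∈G = contradiction x∈G x∉G

        V : ℕ → Fin n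
        V x = index-of-var (any? (var? x) G)

        open Valuation ℍ.fronton V

        rep-⇨-∈D : ∀ {φ} → φ ∈ D → rep (eval φ) ≈ φ → ∀ b → rep (b ⇨ eval φ) ≈ (rep b ⇒ rep (eval φ))
        rep-⇨-∈D φ∈D φ≈ b = rep-⇨ (Eq.trans (proj₂ (rep-index (closure-⇨ (rep-∈ b) φ∈D)))
                                            (⇨-cong Eq.refl (Eq.sym φ≈)))

        rep-⇨-∈G : ∀ {φ ψ} → (φ ⇒ ψ) ∈ G → rep (eval φ) ≈ φ → rep (eval ψ) ≈ ψ →
                   rep (eval φ ⇨ eval ψ) ≈ (rep (eval φ) ⇒ rep (eval ψ))
        rep-⇨-∈G φ⇒ψ∈G φ≈ ψ≈ = rep-⇨ (Eq.trans (proj₂ (rep-index (closure-gen φ⇒ψ∈G)))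
                                               (⇨-cong (Eq.sym φ≈) (Eq.sym ψ≈)))

        rep-box-∈G : ∀ {φ} → ⊠ φ ∈ G → rep (eval φ) ≈ φ → rep (box (eval φ)) ≈ ⊠ (rep (eval φ))
        rep-box-∈G ⊠φ∈G φ≈ = rep-box
          (Eq.trans (proj₂ (rep-index (closure-gen ⊠φ∈G))) (⊠-cong (Eq.sym φ≈)))
          (rep-⇨-∈D (⊠∈G⇒∈D ⊠φ∈G) φ≈)

        rep-eval′ : ∀ φ → subformulas φ ⊆ G → rep (eval φ) ≈ φ
        rep-eval′ (var x)  sub⊆ = rep-index-of-var (any? (var? x) G) (sub⊆ (here refl))
        rep-eval′ (α ∧' β) sub⊆ = Eq.trans rep-∧
          (∧-cong (rep-eval′ α (sub⊆ ∘ there ∘ ∈-++⁺ˡ))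
                  (rep-eval′ β (sub⊆ ∘ there ∘ ∈-++⁺ʳ (subformulas α))))
        rep-eval′ (α ∨' β) sub⊆ = Eq.trans rep-∨
          (∨-cong (rep-eval′ α (sub⊆ ∘ there ∘ ∈-++⁺ˡ))
                  (rep-eval′ β (sub⊆ ∘ there ∘ ∈-++⁺ʳ (subformulas α))))
        rep-eval′ (α ⇒ β)  sub⊆ = Eq.trans (rep-⇨-∈G (sub⊆ (here refl)) α≈ β≈) (⇨-cong α≈ β≈)
          where
          α≈ = rep-eval′ α (sub⊆ ∘ there ∘ ∈-++⁺ˡ)
          β≈ = rep-eval′ β (sub⊆ ∘ there ∘ ∈-++⁺ʳ (subformulas α))
        rep-eval′ (⊠ α)    sub⊆ = Eq.trans (rep-box-∈G (sub⊆ (here refl)) α≈) (⊠-cong α≈)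
          where α≈ = rep-eval′ α (sub⊆ ∘ there)
        rep-eval′ ⊥'       sub⊆ = proj₂ bot-index
        rep-eval′ ⊤'       sub⊆ = proj₂ top-index

        rep-eval : ∀ {φ} → φ ∈ G → rep (eval φ) ≈ φ
        rep-eval {φ} φ∈G = rep-eval′ φ (G-sub φ∈G)

        ∈D⊠? : ∀ a → Dec _
        ∈D⊠? a = any? (λ φ → eval φ ≟ a) D

        ∈D→? : ∀ a b → Dec _
        ∈D→? a b = any? (λ (φ , ψ) → (eval φ ≟ a) ×-dec (eval ψ ≟ b)) (concatMap impArgs G)

        code : Code
        code = record
          { 𝕃    = 𝕃
          -- The first disjunct admits every pair whose second member is in `D⊠`, as `D-ok` demands;
          -- the second covers the implications in `G`.
          ; D→   = λ a b → does (∈D⊠? b) or does (∈D→? a b)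
          ; D⊠   = λ a → does (∈D⊠? a)
          ; D-ok = λ a a∈ b → cong (_or does (∈D→? b a)) a∈
          }

        open CanonicalRule ⟦ code ⟧

        rep-box-D⊠ : ∀ {a} → does (∈D⊠? a) ≡ true → rep (box a) ≈ ⊠ (rep a)
        rep-box-D⊠ {a} p = from (find (does-true (∈D⊠? a) p))
          where
          from : (∃ λ φ → φ ∈ D × eval φ ≡ a) → rep (box a) ≈ ⊠ (rep a)
          from (φ , φ∈D , refl) = rep-box-∈G (∈D⇒⊠∈G φ∈D) (rep-eval (D⊆G φ∈D))

        rep-⇨-D→ : ∀ {a b} → Code.D→ code a b ≡ true → rep (a ⇨ b) ≈ (rep a ⇒ rep b)
        rep-⇨-D→ {a} {b} p = [ from-D ∘ find ∘ does-true (∈D⊠? b) , from-G ∘ find ∘ does-true (∈D→? a b) ]′ (or-true _ p)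
          where
          from-D : (∃ λ φ → φ ∈ D × eval φ ≡ b) → rep (a ⇨ b) ≈ (rep a ⇒ rep b)
          from-D (φ , φ∈D , refl) = rep-⇨-∈D φ∈D (rep-eval (D⊆G φ∈D)) a
          from-G : (∃ λ (φ , ψ) → (φ , ψ) ∈ concatMap impArgs G × eval φ ≡ a × eval ψ ≡ b) →
                   rep (a ⇨ b) ≈ (rep a ⇒ rep b)
          from-G ((φ , ψ) , φψ∈ , refl , refl) = rep-⇨-∈G φ⇒ψ∈G
            (rep-eval (G-sub φ⇒ψ∈G (there (∈-++⁺ˡ (self∈subformulas φ)))))
            (rep-eval (G-sub φ⇒ψ∈G (there (∈-++⁺ʳ (subformulas φ) (self∈subformulas ψ)))))
            where φ⇒ψ∈G = ∈impArgs⇒⇒∈G φψ∈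

        premise-derivable : ∀ {γ} → Premise γ → ⊢ sub σ γ
        premise-derivable bot-premise       = ≈⇒⇔ (proj₂ bot-index)
        premise-derivable top-premise       = ≈⇒⇔ (proj₂ top-index)
        premise-derivable (∧-premise a b)   = ≈⇒⇔ rep-∧
        premise-derivable (∨-premise a b)   = ≈⇒⇔ rep-∨
        premise-derivable (⇨-premise a b p) = ≈⇒⇔ (rep-⇨-D→ p)
        premise-derivable (box-premise a p) = ≈⇒⇔ (rep-box-D⊠ p)

        prem∈G : ∀ {φ} → φ ∈ prem → φ ∈ G
        prem∈G {φ} φ∈ = rule-sub (∈-++⁺ˡ φ∈) (self∈subformulas φ)

        concl∈G : ∀ {φ} → φ ∈ concl → φ ∈ G
        concl∈G {φ} φ∈ = rule-sub (∈-++⁺ʳ prem φ∈) (self∈subformulas φ)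

        prem-true⊎ : ∀ {φ} → φ ∈ prem → eval φ ≡ top ⊎ S (Γ / Δ)
        prem-true⊎ φ∈ = [ (λ top≤φ → inj₁ (ℍ-Heyting.antisym (ℍ-Heyting.maximum _) top≤φ)) , inj₂ ]′
          (leq-complete (≤-trans (const (⊢-hyp (prem⊆Γ φ∈))) (proj₂ (rep-eval (prem∈G φ∈)))))

        concl-false⊎ : ∀ {φ} → φ ∈ concl → eval φ ≢ top ⊎ S (Γ / Δ)
        concl-false⊎ {φ} φ∈ with eval φ ≟ top
        ... | no  φ≢top = inj₁ φ≢top
        ... | yes φ≡top = inj₂ (⊢-close (concl⊆Δ φ∈) (⊤≤⇒⊢ (proj₁ (Eq.trans
          (subst (λ i → ⊤' ≈ rep i) (sym φ≡top) (Eq.sym (proj₂ top-index)))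
          (rep-eval (concl∈G φ∈))))))

        -- For distinct `a` and `b` an implication between `rep a` and `rep b` lies in `Δ`, so
        -- assuming their equivalence derives the sequent.
        derivable-from-canonical : S (ξ ⟦ code ⟧) → S (Γ / Δ)
        derivable-from-canonical = cut-canonical-rule S-ext σ premise-derivable λ {a} {b} a≢b →
          let module W = Sequent S-ext ((rep a ⇔ rep b) ∷ Γ) Δ
              a≈b = W.⇔⇒≈ (W.⊢-hyp (here refl))
          in [ (λ p → W.⊢-close p (proj₁ a≈b)) , (λ p → W.⊢-close p (proj₂ a≈b)) ]′ (rep-separated a≢b)

        D→-true : ∀ {φ ψ} → (φ ⇒ ψ) ∈ G → Code.D→ code (eval φ) (eval ψ) ≡ true
        D→-true {φ} {ψ} φ⇒ψ∈G = trans
          (cong (does (∈D⊠? (eval ψ)) or_) (dec-true (∈D→? (eval φ) (eval ψ))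
            (lose (∈-concatMap⁺ impArgs (lose φ⇒ψ∈G (here refl))) (refl , refl))))
          (∨-zeroʳ _)

        D⊠-true : ∀ {φ} → ⊠ φ ∈ G → Code.D⊠ code (eval φ) ≡ true
        D⊠-true {φ} ⊠φ∈G = dec-true (∈D⊠? (eval φ)) (lose (⊠∈G⇒∈D ⊠φ∈G) refl)

        code-refutes : (∀ {φ} → φ ∈ prem → eval φ ≡ top) → (∀ {φ} → φ ∈ concl → eval φ ≢ top) →
                       Refutes ⟦ code ⟧ r
        code-refutes prem-true concl-false = record
          { V = V
          ; G = G
          ; prem-sub    = rule-sub ∘ ∈-++⁺ˡ
          ; concl-sub   = rule-sub ∘ ∈-++⁺ʳ prem
          ; D→-G        = D→-true
          ; D⊠-G        = D⊠-true
          ; prem-true   = prem-true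
          ; concl-false = concl-false
          }

        derivable-from-laws : S (Γ / Δ)
        derivable-from-laws = from (all⊎any prem-true⊎) (all⊎any concl-false⊎)
          where
          from : (∀ {φ} → φ ∈ prem → eval φ ≡ top) ⊎ (∃ λ φ → φ ∈ prem × S (Γ / Δ)) →
                 (∀ {φ} → φ ∈ concl → eval φ ≢ top) ⊎ (∃ λ φ → φ ∈ concl × S (Γ / Δ)) → S (Γ / Δ)
          from (inj₂ (_ , _ , s)) _                  = s
          from (inj₁ _)           (inj₂ (_ , _ , s)) = s
          from (inj₁ prem-true)   (inj₁ concl-false) =
            derivable-from-canonical (canonical code (code-refutes prem-true concl-false))

      derivable : S (Γ / Δ)
      derivable = [ derivable-from-laws , id ]′ laws⊎

  derivable-from-canonical-rules : ∀ {S : Pred Rule 0ℓ} (S-ext : InNExtKMR S) →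
    (∀ c → Refutes ⟦ c ⟧ r → S (ξ ⟦ c ⟧)) → S r
  derivable-from-canonical-rules S-ext canonical =
    split S-ext (cartesianProductWith _⇒_ closure closure) λ prem⊆ concl⊆ d →
      let open Representatives S-ext closure (λ φ∈ ψ∈ → d (∈-cartesianProductWith⁺ _⇒_ φ∈ ψ∈)) in
      Quotient.derivable S-ext (nth φs) n prem⊆ concl⊆ canonical
        rep-∈ rep-index rep-separated leq leq-sound leq-complete

-- Axiomatisation by the canonical rules of the system

⊕R-InNExt : ∀ Ξ → InNExtKMR (KM-R ⊕R Ξ)
⊕R-InNExt Ξ = record
  { isMsiRuleSystem = record
    { refl' = Gen.refl' ; weaken = Gen.weaken ; cut = Gen.cut ; structural = Gen.structural
    ; ipck = Gen.ipck ; modusPonens = Gen.modusPonens ; necessitation = Gen.necessitation }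
  ; extendsKMR = λ _ → gen ∘ inj₁
  }

Gen⊆ : ∀ {L R} → IsMsiRuleSystem L → (∀ {r} → R r → L r) → ∀ {r} → Gen R r → L r
Gen⊆ {L} {R} sys R⊆L = go
  where
  open IsMsiRuleSystem sys
  go : ∀ {r} → Gen R r → L r
  go (gen r∈R)                = R⊆L r∈R
  go (Gen.refl' φ)            = refl' φ
  go (Gen.weaken p q s)       = weaken p q (go s)
  go (Gen.cut s t)            = cut (go s) (go t)
  go (Gen.structural σ s)     = structural σ (go s)
  go (Gen.ipck φ t)           = ipck φ t
  go (Gen.modusPonens φ ψ)    = modusPonens φ ψ
  go (Gen.necessitation φ)    = necessitation φ

theorem5p18 : (L : Pred Rule 0ℓ) → InNExtKMR L →
    Σ Set λ I → Σ (I → PSCRData) λ Ξ →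
    L ≐ (KM-R ⊕R (λ r → Σ I λ i → r ≡ ξ (Ξ i)))
theorem5p18 L L-ext = (∃ λ c → L (ξ ⟦ c ⟧)) , ⟦_⟧ ∘ proj₁ , λ r →
    -- The decomposition is applied inside the axiomatised system; the canonical rules it asks for
    -- are among the axioms because `L` contains `r` and hence derives them.
    (λ r∈L → Decomposition.derivable-from-canonical-rules r (⊕R-InNExt _) λ c refutes →
      gen (inj₂ ((c , Refutation.canonical-rule-derivable L-ext refutes r∈L) , refl)))
  , Gen⊆ isMsiRuleSystem [ extendsKMR _ , (λ { ((_ , ξ∈L) , refl) → ξ∈L }) ]′
  where open InNExtKMR L-ext
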